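{- Let $f\in\mathbb{B}_n$ with $\deg(f)\le 2$. Then the procedure QANFto2XNF (described in the context), applied to $f$, terminates after finitely many steps and returns a 2-XNF representation of $f$.
   Context: $\mathbb{B}_n=\mathbb{F}_2[X_1,\dots,X_n]/\langle X_1^2-X_1,\dots,X_n^2-X_n\rangle$ is the ring of Boolean polynomials, with indeterminates $x_i$ the residue classes of $X_i$. $\mathbb{B}_{n,m}$ is the Boolean polynomial ring in $n+m$ indeterminates $x_1,\dots,x_n,y_1,\dots,y_m$. Every Boolean polynomial is uniquely a sum of distinct square-free terms (products of distinct indeterminates); the set of these terms is its support $\mathrm{Supp}(f)$, and the degree is the maximal degree of a term in the support. A Boolean polynomial is called linear if it lies in the $\mathbb{F}_2$-span of $1$ and the indeterminates; $\mathbb{L}_n=\langle 1,x_1,\dots,x_n\rangle_{\mathbb{F}_2}$. A non-linear term is a term of degree at least $2$. For a subset $S$ of a Boolean polynomial ring in $N$ indeterminates, $\mathcal{Z}(S)\subseteq\mathbb{F}_2^N$ is the set of common zeros of the elements of $S$. For $S\subseteq\mathbb{F}_2^n$ and $T\subseteq\mathbb{F}_2^{n+m}$ write $S\equiv_n T$ if the projection to the first $n$ coordinates restricts to a bijection $T\to S$. A set $S=\{f_1g_1,\dots,f_kg_k,\ell_1,\dots,\ell_s\}\subseteq\mathbb{B}_{n,m}$ (for some $m\ge 0$), with all $f_i,g_i,\ell_j$ linear Boolean polynomials of $\mathbb{B}_{n,m}$, is called a 2-XNF representation of an ideal $I\subseteq\mathbb{B}_n$ if $\mathcal{Z}(I)\equiv_n\mathcal{Z}(S)$.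 A 2-XNF representation of $f\in\mathbb{B}_n$ is a 2-XNF representation of $\langle f\rangle$. Procedure QANFto2XNF. Input $f\in\mathbb{B}_n$ with $\deg(f)\le 2$. Start with $i=0$, $M=\emptyset$. While $\deg(f)=2$: increase $i$ by $1$ and let $y_i$ be a new indeterminate; write $f=\ell_1\ell_2+f'$ for (any choice of) distinct $\ell_1,\ell_2\in\mathbb{L}_n$ and $f'\in\mathbb{B}_{n,i-1}$ such that $\mathrm{Supp}(f')$ contains fewer non-linear terms than $\mathrm{Supp}(f)$; set $f=y_i+f'$; adjoin $y_i(\ell_2+1)$ and $\ell_2(\ell_1+y_i)$ to $M$. Finally return $M\cup\{f\}$. -}

module Defs where

open import Data.Bool using (Bool; true; false; _∧_; _xor_; if_then_else_)
import Data.Bool.Properties as Bool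
open import Data.Fin using (Fin; fromℕ)
open import Data.Fin.Subset using (Subset; inside; outside; _∪_; ⁅_⁆; ∣_∣; ⊥)
open import Data.List as List using (List; []; _∷_; _++_; allFin)
open import Data.List.Extrema.Nat using (max)
open import Data.List.Relation.Unary.Any using (Any)
open import Data.Nat using (ℕ; zero; suc; _+_; _<_; _≤?_)
open import Data.Nat.Properties using (m≤n+m)
open import Data.Product using (Σ; ∃; ∃-syntax; _×_; _,_; proj₁)
open import Data.Sum using (_⊎_)
open import Data.Vec as Vec using (Vec; []; _∷_; init; last; truncate)
import Data.Vec.Properties as Vec
open import Function using (_on_)
open import Function.Definitions using (Bijective)
open import Level using (0ℓ)
open import Relation.Binary using (DecidableEquality)
open import Relation.Binary.Construct.Closure.ReflexiveTransitive using (Star)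
open import Relation.Binary.PropositionalEquality using (_≡_)
open import Relation.Nullary using (¬_; does)
open import Relation.Unary using (Pred; _≐_)

-- F₂ is Bool, with _xor_ as addition and _∧_ as multiplication.

∑ : {A : Set} → List A → (A → Bool) → Bool
∑ xs h = List.foldr _xor_ false (List.map h xs)

-- The square-free term ∏_{i ∈ t} xᵢ is identified with the subset t of its
-- indeterminates.

Term : ℕ → Set
Term = Subset

_≟ₜ_ : ∀ {N} → DecidableEquality (Term N)
_≟ₜ_ = Vec.≡-dec Bool._≟_

-- Each term in N indeterminates occurs exactly once.
terms : ∀ N → List (Term N)
terms zero    = [] ∷ []
terms (suc N) = List.map (outside ∷_) (terms N) ++ List.map (inside ∷_) (terms N)

-- The ring 𝔹_N = F₂[X₁,…,X_N]/⟨Xᵢ² − Xᵢ⟩.  The square-free terms are an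
-- F₂-basis of the quotient, so a residue class is given by its coefficient
-- function on terms.

𝔹 : ℕ → Set
𝔹 N = Term N → Bool

infix  4 _≈_
infixl 6 _⊕_
infixl 7 _⊗_ _·_

_≈_ : ∀ {N} → 𝔹 N → 𝔹 N → Set
f ≈ g = ∀ t → f t ≡ g t

monomial : ∀ {N} → Term N → 𝔹 N
monomial s t = does (s ≟ₜ t)

0# 1# : ∀ {N} → 𝔹 N
0# _ = false
1#   = monomial ⊥

x : ∀ {N} → Fin N → 𝔹 N
x i = monomial ⁅ i ⁆

_⊕_ : ∀ {N} → 𝔹 N → 𝔹 N → 𝔹 N
(f ⊕ g) t = f t xor g t

_·_ : ∀ {N} → Bool → 𝔹 N → 𝔹 N
(c · f) t = c ∧ f t

-- Since xᵢ² = xᵢ, the product of the terms s and t is the term s ∪ t.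
_⊗_ : ∀ {N} → 𝔹 N → 𝔹 N → 𝔹 N
_⊗_ {N} f g u = ∑ (terms N) λ s → ∑ (terms N) λ t → monomial (s ∪ t) u ∧ (f s ∧ g t)

Supp : ∀ {N} → 𝔹 N → List (Term N)
Supp {N} f = List.filter (λ t → f t Bool.≟ true) (terms N)

-- The zero polynomial, whose support is empty, gets degree 0.
deg : ∀ {N} → 𝔹 N → ℕ
deg f = max 0 (List.map ∣_∣ (Supp f))

#nonLinearTerms : ∀ {N} → 𝔹 N → ℕ
#nonLinearTerms f = List.length (List.filter (λ t → 2 ≤? ∣ t ∣) (Supp f))

Linear : ∀ {N} → 𝔹 N → Set
Linear {N} f = ∃[ c₀ ] Σ (Fin N → Bool) λ c →
  f ≈ c₀ · 1# ⊕ List.foldr _⊕_ 0# (List.map (λ i → c i · x i) (allFin N))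

evalTerm : ∀ {N} → Term N → Vec Bool N → Bool
evalTerm t a = Vec.foldr _ _∧_ true (Vec.zipWith (λ tᵢ aᵢ → if tᵢ then aᵢ else true) t a)

eval : ∀ {N} → 𝔹 N → Vec Bool N → Bool
eval f a = ∑ (Supp f) λ t → evalTerm t a

𝒵 : ∀ {N} → Pred (𝔹 N) 0ℓ → Pred (Vec Bool N) 0ℓ
𝒵 S a = ∀ g → S g → eval g a ≡ false

⟨_⟩ : ∀ {N} → 𝔹 N → Pred (𝔹 N) 0ℓ
⟨ f ⟩ g = ∃[ h ] g ≈ h ⊗ f

⟦_⟧ : ∀ {N} → List (𝔹 N) → Pred (𝔹 N) 0ℓ
⟦ fs ⟧ p = Any (p ≈_) fs

-- 𝔹_{n,m} is 𝔹 (m + n): the first n indeterminates are x₁,…,xₙ and the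
-- following ones are y₁,…,yₘ in this order.  Writing m + n rather than n + m
-- makes 𝔹_{n,m+1} reduce to 𝔹 (suc (m + n)), where the last indeterminate is
-- y_{m+1}.

-- The inclusion adding one new last indeterminate.
weaken : ∀ {N} → 𝔹 N → 𝔹 (suc N)
weaken f t = if last t then false else f (init t)

weaken* : ∀ {n} m → 𝔹 n → 𝔹 (m + n)
weaken* zero    f = f
weaken* (suc m) f = weaken (weaken* m f)

project : ∀ n m → Vec Bool (m + n) → Vec Bool n
project n m = truncate (m≤n+m n m)

-- S ≡ₙ[ m ] T: elements of S and of T are compared by their underlying
-- points only, as membership proofs need not be unique.
infix 4 _≡ₙ[_]_

_≡ₙ[_]_ : ∀ {n} → Pred (Vec Bool n) 0ℓ → (m : ℕ) → Pred (Vec Bool (m + n)) 0ℓ → Set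
_≡ₙ[_]_ {n} S m T =
  Σ (∀ b → T b → S (project n m b)) λ maps →
    Bijective {A = Σ (Vec Bool (m + n)) T} {B = Σ (Vec Bool n) S}
      (_≡_ on proj₁) (_≡_ on proj₁)
      (λ (b , b∈T) → project n m b , maps b b∈T)

record Is2XNFRepresentation {n : ℕ} (m : ℕ)
         (I : Pred (𝔹 n) 0ℓ) (S : Pred (𝔹 (m + n)) 0ℓ) : Set where
  field
    k s      : ℕ
    f g      : Fin k → 𝔹 (m + n)
    ℓ        : Fin s → 𝔹 (m + n)
    f-linear : ∀ i → Linear (f i)
    g-linear : ∀ i → Linear (g i)
    ℓ-linear : ∀ j → Linear (ℓ j)
    form     : S ≐ λ p → (∃[ i ] p ≈ f i ⊗ g i) ⊎ (∃[ j ] p ≈ ℓ j)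
    zeros    : 𝒵 I ≡ₙ[ m ] 𝒵 S

-- QANFto2XNF as a nondeterministic transition system: a transition is one
-- pass through the loop body with some admissible choice of ℓ₁, ℓ₂, f′.

record State (n : ℕ) : Set where
  constructor state
  field
    i : ℕ
    M : List (𝔹 (i + n))
    f : 𝔹 (i + n)

start : ∀ {n} → 𝔹 n → State n
start f = state 0 [] f

infix 4 _⟶_ _⟶*_

data _⟶_ {n : ℕ} : State n → State n → Set where
  step : ∀ {i M f} →
         deg f ≡ 2 →
         (ℓ₁ ℓ₂ : 𝔹 n) (f′ : 𝔹 (i + n)) →
         Linear ℓ₁ → Linear ℓ₂ → ¬ (ℓ₁ ≈ ℓ₂) →
         f ≈ weaken* i ℓ₁ ⊗ weaken* i ℓ₂ ⊕ f′ →
         #nonLinearTerms f′ < #nonLinearTerms f →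
         let y  = x (fromℕ (i + n))
             L₁ = weaken* (suc i) ℓ₁
             L₂ = weaken* (suc i) ℓ₂
         in state i M f ⟶
            state (suc i)
                  (y ⊗ (L₂ ⊕ 1#) ∷ L₂ ⊗ (L₁ ⊕ y) ∷ List.map weaken M)
                  (y ⊕ weaken f′)

_⟶*_ : ∀ {n} → State n → State n → Set
_⟶*_ = Star _⟶_

LoopGuard : ∀ {n} → State n → Set
LoopGuard s = deg (State.f s) ≡ 2

-- The set M ∪ {f}.
output : ∀ {n} (s : State n) → Pred (𝔹 (State.i s + n)) 0ℓ
output (state _ M f) = ⟦ f ∷ M ⟧

-- The two products adjoined for ℓ₁ℓ₂ force y = ℓ₁ℓ₂: where ℓ₂ = 1 the second
-- gives y = ℓ₁, and where ℓ₂ = 0 the first gives y = 0.  Hence every new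
-- indeterminate is a function of the old ones, and substituting y for ℓ₁ℓ₂ does
-- not change the zeros.  Only terms in x₁,…,xₙ are ever quadratic, as each loop
-- pass changes f by a quadratic polynomial in the x's and a new linear term; so
-- as long as deg f = 2, some xₐx_b ∈ Supp f can be split off.  The number of
-- non-linear terms decreases in each pass.
module Submission where

open import Algebra.Bundles using (CommutativeMonoid; CommutativeRing)
import Algebra.Properties.CommutativeSemigroup as CommutativeSemigroup
open import Data.Bool using (Bool; true; false; _∧_; _xor_; if_then_else_)
open import Data.Bool.Properties as Bool
  using (xor-assoc; xor-identityʳ; ∧-assoc; ∧-comm; ∧-identityʳ; ∧-zeroʳ; ∧-conicalˡ; ∧-conicalʳ;
         ∧-distribʳ-xor; ¬-not; xor-∧-commutativeRing)
open import Data.Bool.Solver using (module xor-∧-Solver)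
open import Data.Fin using (Fin; zero; suc; fromℕ)
open import Data.Fin.Subset as Subset using (inside; outside; _∪_; ⁅_⁆; ∣_∣; ⊥)
open import Data.Fin.Subset.Properties
  using (∣⊥∣≡0; ∣⁅x⁆∣≡1; ∪-identityˡ; ∪-identityʳ; ∪-idem; x∈⁅x⁆; x∈⁅y⁆⇒x≡y)
open import Data.List as List using (List; []; _∷_; _++_; allFin; length)
open import Data.List.Extrema.Nat using (argmax-sel; xs≤max; f[argmax]≤v⁺)
open import Data.List.Membership.Propositional using (_∈_)
open import Data.List.Membership.Propositional.Properties
  using (∈-map⁺; ∈-map⁻; ∈-++⁺ˡ; ∈-++⁺ʳ; ∈-filter⁺; ∈-filter⁻; ∈-lookup; ∈-allFin)
import Data.List.Properties as List
open import Data.List.Relation.Binary.Permutation.Propositional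
  using (_↭_; ↭-refl; ↭⇒↭ₛ; module PermutationReasoning)
open import Data.List.Relation.Binary.Permutation.Propositional.Properties
  using (map⁺; ++⁺; ++-commutativeMonoid; filter-↭; ↭-length)
import Data.List.Relation.Binary.Permutation.Setoid.Properties as Permutation
open import Data.List.Relation.Unary.All as All using (All; []; _∷_)
import Data.List.Relation.Unary.All.Properties as All
open import Data.List.Relation.Unary.AllPairs using ([]; _∷_)
open import Data.List.Relation.Unary.Any as Any using (here; there)
open import Data.List.Relation.Unary.Any.Properties using (lookup-index)
open import Data.List.Relation.Unary.Unique.Propositional using (Unique)
import Data.List.Relation.Unary.Unique.Propositional.Properties as Unique
open import Data.Nat using (ℕ; zero; suc; _+_; _≤_; _<_; z≤n; s≤s; _≤?_)
open import Data.Nat.Induction using (<-wellFounded)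
import Data.Nat.Properties as ℕ
open import Data.Product using (Σ; ∃; ∃-syntax; ∃₂; _×_; _,_; proj₁; proj₂)
open import Data.Sum using (_⊎_; inj₁; inj₂)
open import Data.Vec as Vec using (Vec; []; _∷_; init; last; truncate; initLast; _∷ʳ_)
import Data.Vec.Properties as Vec
open import Function using (_∘_; id; flip)
open import Induction.WellFounded using (Acc; WellFounded; module Subrelation)
import Relation.Binary.Construct.On as On
open import Relation.Binary.Construct.Closure.ReflexiveTransitive using (ε; _◅_)
open import Relation.Binary.PropositionalEquality
  using (_≡_; _≢_; refl; sym; trans; cong; cong₂; subst; setoid; module ≡-Reasoning)
open import Relation.Nullary using (¬_; yes; no; does; contradiction)
open import Relation.Nullary.Decidable using (dec-true; dec-false)
open import Defs

-- The choice in a loop pass is free, but `ℓ₁` and `ℓ₂` must be polynomials in the `x`'s alone. A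
-- quadratic term containing some `y` could therefore never be split off. To exclude such terms,
-- `Invariant` carries a decomposition of `f` into a polynomial of degree at most 2 in the `x`'s and
-- a remainder of degree at most 1 in all indeterminates. No choice can spoil it: over F₂ the
-- factors determine `f′` as `f + ℓ₁ℓ₂`, so the product joins the first part and the new `y` joins
-- the second.
--
-- A product `⊗` is a convolution over pairs of terms and is awkward to handle by coefficients.
-- Identities between polynomials are therefore mostly checked pointwise: `eval` respects sums and
-- products, and by `eval-injective` a Boolean polynomial is determined by its values. Degrees and
-- numbers of terms, by contrast, are read off the coefficients.

private
  variable
    A B : Set
    N n d d′ : ℕ

-- Sums over F₂

∑-cong : ∀ (xs : List A) {g h : A → Bool} → (∀ a → g a ≡ h a) → ∑ xs g ≡ ∑ xs h
∑-cong []       eq = refl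
∑-cong (a ∷ xs) eq = cong₂ _xor_ (eq a) (∑-cong xs eq)

∑-false : ∀ (xs : List A) → ∑ xs (λ _ → false) ≡ false
∑-false []       = refl
∑-false (_ ∷ xs) = ∑-false xs

∑-xor : ∀ (xs : List A) (g h : A → Bool) → ∑ xs (λ a → g a xor h a) ≡ ∑ xs g xor ∑ xs h
∑-xor []       g h = refl
∑-xor (a ∷ xs) g h = trans (cong ((g a xor h a) xor_) (∑-xor xs g h))
  (solve 4 (λ p q r s → (p :+ q) :+ (r :+ s) := (p :+ r) :+ (q :+ s)) refl
    (g a) (h a) (∑ xs g) (∑ xs h))
  where open xor-∧-Solver

∑-∧ˡ : ∀ c (xs : List A) (h : A → Bool) → ∑ xs (λ a → c ∧ h a) ≡ c ∧ ∑ xs h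
∑-∧ˡ false xs h = ∑-false xs
∑-∧ˡ true  xs h = refl

∑-∧ʳ : ∀ c (xs : List A) (h : A → Bool) → ∑ xs (λ a → h a ∧ c) ≡ ∑ xs h ∧ c
∑-∧ʳ c xs h = begin
  ∑ xs (λ a → h a ∧ c) ≡⟨ ∑-cong xs (λ a → ∧-comm (h a) c) ⟩
  ∑ xs (λ a → c ∧ h a) ≡⟨ ∑-∧ˡ c xs h ⟩
  c ∧ ∑ xs h           ≡⟨ ∧-comm c _ ⟩
  ∑ xs h ∧ c           ∎
  where open ≡-Reasoning

∑-comm : ∀ (xs : List A) (ys : List B) (h : A → B → Bool) →
         ∑ xs (λ a → ∑ ys (h a)) ≡ ∑ ys (λ b → ∑ xs (flip h b))
∑-comm []       ys h = sym (∑-false ys)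
∑-comm (a ∷ xs) ys h = trans (cong (∑ ys (h a) xor_) (∑-comm xs ys h))
                             (sym (∑-xor ys (h a) _))

∑-++ : ∀ (xs ys : List A) (h : A → Bool) → ∑ (xs ++ ys) h ≡ ∑ xs h xor ∑ ys h
∑-++ []       ys h = refl
∑-++ (a ∷ xs) ys h = trans (cong (h a xor_) (∑-++ xs ys h)) (sym (xor-assoc (h a) _ _))

∑-map : ∀ (φ : A → B) xs (h : B → Bool) → ∑ (List.map φ xs) h ≡ ∑ xs (h ∘ φ)
∑-map φ []       h = refl
∑-map φ (a ∷ xs) h = cong (h (φ a) xor_) (∑-map φ xs h)

∑-↭ : ∀ {xs ys : List A} (h : A → Bool) → xs ↭ ys → ∑ xs h ≡ ∑ ys h
∑-↭ h xs↭ys = Permutation.foldr-commMonoid (setoid Bool) +-isCommutativeMonoid (↭⇒↭ₛ (map⁺ h xs↭ys))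
  where open CommutativeRing xor-∧-commutativeRing using (+-isCommutativeMonoid)

∑-true : ∀ (xs : List A) (h : A → Bool) → ∑ xs h ≡ true → ∃[ a ] h a ≡ true
∑-true (a ∷ xs) h ∑≡true with h a in eq
... | true  = a , eq
... | false = ∑-true xs h ∑≡true

∑-vanishing : ∀ {xs : List A} {h : A → Bool} → All (λ a → h a ≡ false) xs → ∑ xs h ≡ false
∑-vanishing []         = refl
∑-vanishing (eq ∷ eqs) = cong₂ _xor_ eq (∑-vanishing eqs)

∑-single : ∀ {xs : List A} {a} {h : A → Bool} → Unique xs → a ∈ xs →
           (∀ {b} → a ≢ b → h b ≡ false) → ∑ xs h ≡ h a
∑-single {a = a} {h} (a≢ ∷ _) (here refl) h≡false =
  trans (cong (h a xor_) (∑-vanishing (All.map h≡false a≢))) (xor-identityʳ _)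
∑-single (b≢ ∷ u) (there a∈xs) h≡false =
  cong₂ _xor_ (h≡false (All.lookup b≢ a∈xs ∘ sym)) (∑-single u a∈xs h≡false)

∑-filter : ∀ (p h : A → Bool) xs →
           ∑ (List.filter (λ a → p a Bool.≟ true) xs) h ≡ ∑ xs (λ a → p a ∧ h a)
∑-filter p h []       = refl
∑-filter p h (a ∷ xs) with p a
... | true  = cong (h a xor_) (∑-filter p h xs)
... | false = ∑-filter p h xs

-- Enumeration of the square-free terms

terms-complete : (t : Term N) → t ∈ terms N
terms-complete []            = here refl
terms-complete (outside ∷ t) = ∈-++⁺ˡ (∈-map⁺ _ (terms-complete t))
terms-complete {suc N} (inside ∷ t) =
  ∈-++⁺ʳ (List.map (outside ∷_) (terms N)) (∈-map⁺ _ (terms-complete t))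

terms-unique : ∀ N → Unique (terms N)
terms-unique zero    = [] ∷ []
terms-unique (suc N) =
  Unique.++⁺ (Unique.map⁺ Vec.∷-injectiveʳ (terms-unique N))
             (Unique.map⁺ Vec.∷-injectiveʳ (terms-unique N))
             λ where (p , q) → disjoint (∈-map⁻ _ p) (∈-map⁻ _ q)
  where
  disjoint : ∀ {v : Term (suc N)} →
             ∃ (λ t → t ∈ terms N × v ≡ outside ∷ t) → ¬ ∃ (λ t → t ∈ terms N × v ≡ inside ∷ t)
  disjoint (_ , _ , refl) (_ , _ , ())

map-∷-∷ʳ : ∀ b c (ts : List (Term N)) →
           List.map (b ∷_) (List.map (_∷ʳ c) ts) ≡ List.map (_∷ʳ c) (List.map (b ∷_) ts)
map-∷-∷ʳ b c ts = trans (sym (List.map-∘ ts)) (List.map-∘ ts)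

-- `terms` branches on the first indeterminate, whereas `weaken` adds the new one at the end. Sums
-- and counts do not depend on the order of the list, so a permutation is enough to pass from one
-- branching to the other.
terms-∷ʳ : ∀ N → terms (suc N) ↭ List.map (_∷ʳ outside) (terms N) ++ List.map (_∷ʳ inside) (terms N)
terms-∷ʳ zero    = ↭-refl
terms-∷ʳ (suc N) = begin
  o∷ (terms (suc N)) ++ i∷ (terms (suc N))
    ↭⟨ ++⁺ (map⁺ _ (terms-∷ʳ N)) (map⁺ _ (terms-∷ʳ N)) ⟩
  o∷ (∷ʳo T ++ ∷ʳi T) ++ i∷ (∷ʳo T ++ ∷ʳi T)
    ≡⟨ cong₂ _++_ (List.map-++ _ (∷ʳo T) _) (List.map-++ _ (∷ʳo T) _) ⟩
  (o∷ (∷ʳo T) ++ o∷ (∷ʳi T)) ++ (i∷ (∷ʳo T) ++ i∷ (∷ʳi T))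
    -- The four blocks are indexed by first and last coordinate; exchanging the two middle ones
    -- groups them by the last instead of the first.
    ↭⟨ interchange (o∷ (∷ʳo T)) _ _ _ ⟩
  (o∷ (∷ʳo T) ++ i∷ (∷ʳo T)) ++ (o∷ (∷ʳi T) ++ i∷ (∷ʳi T))
    ≡⟨ cong₂ _++_ (cong₂ _++_ (map-∷-∷ʳ _ _ T) (map-∷-∷ʳ _ _ T))
                  (cong₂ _++_ (map-∷-∷ʳ _ _ T) (map-∷-∷ʳ _ _ T)) ⟩
  (∷ʳo (o∷ T) ++ ∷ʳo (i∷ T)) ++ (∷ʳi (o∷ T) ++ ∷ʳi (i∷ T))
    ≡⟨ cong₂ _++_ (List.map-++ _ (o∷ T) _) (List.map-++ _ (o∷ T) _) ⟨
  ∷ʳo (terms (suc N)) ++ ∷ʳi (terms (suc N)) ∎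
  where
  open PermutationReasoning
  open CommutativeSemigroup
    (CommutativeMonoid.commutativeSemigroup (++-commutativeMonoid {A = Term (suc (suc N))}))
    using (interchange)
  T = terms N
  o∷ i∷ ∷ʳo ∷ʳi : ∀ {M} → List (Term M) → List (Term (suc M))
  o∷  = List.map (outside ∷_)
  i∷  = List.map (inside ∷_)
  ∷ʳo = List.map (_∷ʳ outside)
  ∷ʳi = List.map (_∷ʳ inside)

∑-terms-∷ : ∀ N (h : Term (suc N) → Bool) →
            ∑ (terms (suc N)) h ≡ ∑ (terms N) (h ∘ (outside ∷_)) xor ∑ (terms N) (h ∘ (inside ∷_))
∑-terms-∷ N h = trans (∑-++ (List.map _ (terms N)) _ h)
  (cong₂ _xor_ (∑-map _ (terms N) h) (∑-map _ (terms N) h))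

∑-terms-∷ʳ : ∀ N (h : Term (suc N) → Bool) →
             ∑ (terms (suc N)) h ≡ ∑ (terms N) (h ∘ (_∷ʳ outside)) xor ∑ (terms N) (h ∘ (_∷ʳ inside))
∑-terms-∷ʳ N h =
  trans (∑-↭ h (terms-∷ʳ N))
        (trans (∑-++ (List.map _ (terms N)) _ h)
               (cong₂ _xor_ (∑-map _ (terms N) h) (∑-map _ (terms N) h)))

init-last : (v : Vec A (suc N)) → v ≡ init v ∷ʳ last v
init-last v = proj₂ (proj₂ (initLast v))

-- Evaluation

-- Turns the support into a factor of the summand, so that the range of summation is the same for
-- all polynomials and sums can be added and exchanged.
eval-∑ : ∀ (f : 𝔹 N) a → eval f a ≡ ∑ (terms N) (λ t → f t ∧ evalTerm t a)
eval-∑ {N} f a = ∑-filter f (λ t → evalTerm t a) (terms N)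

eval-cong : ∀ {f g : 𝔹 N} → f ≈ g → ∀ a → eval f a ≡ eval g a
eval-cong {N} {f} {g} f≈g a = begin
  eval f a                                  ≡⟨ eval-∑ f a ⟩
  ∑ (terms N) (λ t → f t ∧ evalTerm t a)    ≡⟨ ∑-cong (terms N) (λ t → cong (_∧ _) (f≈g t)) ⟩
  ∑ (terms N) (λ t → g t ∧ evalTerm t a)    ≡⟨ eval-∑ g a ⟨
  eval g a                                  ∎
  where open ≡-Reasoning

eval-⊕ : ∀ (f g : 𝔹 N) a → eval (f ⊕ g) a ≡ eval f a xor eval g a
eval-⊕ {N} f g a = begin
  eval (f ⊕ g) a
    ≡⟨ eval-∑ (f ⊕ g) a ⟩
  ∑ (terms N) (λ t → (f t xor g t) ∧ evalTerm t a)
    ≡⟨ ∑-cong (terms N) (λ t → ∧-distribʳ-xor (evalTerm t a) (f t) (g t)) ⟩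
  ∑ (terms N) (λ t → (f t ∧ evalTerm t a) xor (g t ∧ evalTerm t a))
    ≡⟨ ∑-xor (terms N) _ _ ⟩
  ∑ (terms N) (λ t → f t ∧ evalTerm t a) xor ∑ (terms N) (λ t → g t ∧ evalTerm t a)
    ≡⟨ cong₂ _xor_ (eval-∑ f a) (eval-∑ g a) ⟨
  eval f a xor eval g a ∎
  where open ≡-Reasoning

monomial-refl : ∀ (s : Term N) → monomial s s ≡ true
monomial-refl s = dec-true (s ≟ₜ s) refl

monomial-≢ : ∀ {s t : Term N} → s ≢ t → monomial s t ≡ false
monomial-≢ {s = s} {t} s≢t = dec-false (s ≟ₜ t) s≢t

monomial-true : ∀ (s t : Term N) → monomial s t ≡ true → s ≡ t
monomial-true s t eq with yes s≡t ← s ≟ₜ t = s≡t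

eval-monomial : ∀ (s : Term N) a → eval (monomial s) a ≡ evalTerm s a
eval-monomial {N} s a = begin
  eval (monomial s) a
    ≡⟨ eval-∑ (monomial s) a ⟩
  ∑ (terms N) (λ t → monomial s t ∧ evalTerm t a)
    ≡⟨ ∑-single (terms-unique N) (terms-complete s) (λ s≢t → cong (_∧ _) (monomial-≢ s≢t)) ⟩
  monomial s s ∧ evalTerm s a
    ≡⟨ cong (_∧ evalTerm s a) (monomial-refl s) ⟩
  evalTerm s a ∎
  where open ≡-Reasoning

evalTerm-⊥ : ∀ (a : Vec Bool N) → evalTerm ⊥ a ≡ true
evalTerm-⊥ []      = refl
evalTerm-⊥ (_ ∷ a) = evalTerm-⊥ a

eval-1# : ∀ (a : Vec Bool N) → eval 1# a ≡ true
eval-1# a = trans (eval-monomial ⊥ a) (evalTerm-⊥ a)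

evalTerm-∪ : ∀ (s t : Term N) a → evalTerm (s ∪ t) a ≡ evalTerm s a ∧ evalTerm t a
evalTerm-∪ []            []            []          = refl
evalTerm-∪ (outside ∷ s) (outside ∷ t) (_ ∷ a)     = evalTerm-∪ s t a
evalTerm-∪ (outside ∷ s) (inside ∷ t)  (false ∷ a) = sym (∧-zeroʳ _)
evalTerm-∪ (outside ∷ s) (inside ∷ t)  (true ∷ a)  = evalTerm-∪ s t a
evalTerm-∪ (inside ∷ s)  (_ ∷ t)       (false ∷ a) = refl
evalTerm-∪ (inside ∷ s)  (outside ∷ t) (true ∷ a)  = evalTerm-∪ s t a
evalTerm-∪ (inside ∷ s)  (inside ∷ t)  (true ∷ a)  = evalTerm-∪ s t a

evalTerm-∷ʳ : ∀ (t : Term N) b a c →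
              evalTerm (t ∷ʳ b) (a ∷ʳ c) ≡ evalTerm t a ∧ (if b then c else true)
evalTerm-∷ʳ []      b []      c = ∧-identityʳ _
evalTerm-∷ʳ (e ∷ t) b (d ∷ a) c =
  trans (cong ((if e then d else true) ∧_) (evalTerm-∷ʳ t b a c))
        (sym (∧-assoc (if e then d else true) _ _))

-- After the sum over the product term `u` is moved innermost, only `u = s ∪ t` survives in it.
-- Since `evalTerm` turns unions into products, the remaining double sum factors.
eval-⊗ : ∀ (f g : 𝔹 N) a → eval (f ⊗ g) a ≡ eval f a ∧ eval g a
eval-⊗ {N} f g a = begin
  eval (f ⊗ g) a
    ≡⟨ eval-∑ (f ⊗ g) a ⟩
  ∑ T (λ u → ∑ T (λ s → ∑ T λ t → c s t u) ∧ e u)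
    ≡⟨ ∑-cong T (λ u → trans (sym (∑-∧ʳ (e u) T _)) (∑-cong T λ s → sym (∑-∧ʳ (e u) T _))) ⟩
  ∑ T (λ u → ∑ T λ s → ∑ T λ t → c s t u ∧ e u)
    ≡⟨ ∑-comm T T _ ⟩
  ∑ T (λ s → ∑ T λ u → ∑ T λ t → c s t u ∧ e u)
    ≡⟨ ∑-cong T (λ s → ∑-comm T T _) ⟩
  ∑ T (λ s → ∑ T λ t → ∑ T λ u → c s t u ∧ e u)
    ≡⟨ ∑-cong T (λ s → ∑-cong T λ t → inner s t) ⟩
  ∑ T (λ s → ∑ T λ t → (f s ∧ e s) ∧ (g t ∧ e t))
    ≡⟨ ∑-cong T (λ s → ∑-∧ˡ (f s ∧ e s) T _) ⟩
  ∑ T (λ s → (f s ∧ e s) ∧ ∑ T (λ t → g t ∧ e t))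
    ≡⟨ ∑-∧ʳ _ T _ ⟩
  ∑ T (λ s → f s ∧ e s) ∧ ∑ T (λ t → g t ∧ e t)
    ≡⟨ cong₂ _∧_ (eval-∑ f a) (eval-∑ g a) ⟨
  eval f a ∧ eval g a ∎
  where
  open ≡-Reasoning
  open xor-∧-Solver
  T = terms N
  e : Term N → Bool
  e t = evalTerm t a
  c : Term N → Term N → Term N → Bool
  c s t u = monomial (s ∪ t) u ∧ (f s ∧ g t)
  inner : ∀ s t → ∑ T (λ u → c s t u ∧ e u) ≡ (f s ∧ e s) ∧ (g t ∧ e t)
  inner s t = begin
    ∑ T (λ u → c s t u ∧ e u)
      ≡⟨ ∑-cong T (λ u → solve 3 (λ m d e → (m :* d) :* e := d :* (m :* e)) refl
                           (monomial (s ∪ t) u) (f s ∧ g t) (e u)) ⟩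
    ∑ T (λ u → (f s ∧ g t) ∧ (monomial (s ∪ t) u ∧ e u))
      ≡⟨ ∑-∧ˡ (f s ∧ g t) T _ ⟩
    (f s ∧ g t) ∧ ∑ T (λ u → monomial (s ∪ t) u ∧ e u)
      -- The sum over `u` is itself the evaluation of a monomial.
      ≡⟨ cong ((f s ∧ g t) ∧_) (trans (sym (eval-∑ (monomial (s ∪ t)) a)) (eval-monomial (s ∪ t) a)) ⟩
    (f s ∧ g t) ∧ e (s ∪ t)
      ≡⟨ cong ((f s ∧ g t) ∧_) (evalTerm-∪ s t a) ⟩
    (f s ∧ g t) ∧ (e s ∧ e t)
      ≡⟨ solve 4 (λ p q r s → (p :* q) :* (r :* s) := (p :* r) :* (q :* s)) refl (f s) (g t) (e s) (e t) ⟩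
    (f s ∧ e s) ∧ (g t ∧ e t) ∎

-- This is the decomposition `f = f₀ + x₁ f₁` with `f₀` and `f₁` free of the first indeterminate,
-- read at a point.
eval-∷ : ∀ (f : 𝔹 (suc N)) c a →
         eval f (c ∷ a) ≡ eval (f ∘ (outside ∷_)) a xor (c ∧ eval (f ∘ (inside ∷_)) a)
eval-∷ {N} f c a = begin
  eval f (c ∷ a)
    ≡⟨ eval-∑ f (c ∷ a) ⟩
  ∑ (terms (suc N)) (λ t → f t ∧ evalTerm t (c ∷ a))
    ≡⟨ ∑-terms-∷ N (λ t → f t ∧ evalTerm t (c ∷ a)) ⟩
  ∑ (terms N) (λ t → f (outside ∷ t) ∧ evalTerm t a) xor
  ∑ (terms N) (λ t → f (inside ∷ t) ∧ (c ∧ evalTerm t a))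
    ≡⟨ cong₂ _xor_ (sym (eval-∑ (f ∘ (outside ∷_)) a))
                   (∑-cong (terms N) λ t → swap (f (inside ∷ t)) (evalTerm t a)) ⟩
  eval (f ∘ (outside ∷_)) a xor ∑ (terms N) (λ t → c ∧ (f (inside ∷ t) ∧ evalTerm t a))
    ≡⟨ cong (eval (f ∘ (outside ∷_)) a xor_)
            (trans (∑-∧ˡ c (terms N) _) (cong (c ∧_) (sym (eval-∑ (f ∘ (inside ∷_)) a)))) ⟩
  eval (f ∘ (outside ∷_)) a xor (c ∧ eval (f ∘ (inside ∷_)) a) ∎
  where
  open ≡-Reasoning
  open xor-∧-Solver
  swap : ∀ p e → p ∧ (c ∧ e) ≡ c ∧ (p ∧ e)
  swap p e = solve 3 (λ p c e → p :* (c :* e) := c :* (p :* e)) refl p c e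

xor-cancelˡ : ∀ a {b c} → a xor b ≡ a xor c → b ≡ c
xor-cancelˡ false eq = eq
xor-cancelˡ true  eq = Bool.not-injective eq

-- Induction on the number of indeterminates with `f = f₀ + x₁ f₁`: the points with first coordinate
-- 0 determine `f₀`, and those with first coordinate 1 determine `f₀ + f₁`, from which `f₀` cancels.
eval-injective : ∀ {f g : 𝔹 N} → (∀ a → eval f a ≡ eval g a) → f ≈ g
eval-injective {zero} {f} {g} eq [] = begin
  f []      ≡⟨ eval-[] f ⟨
  eval f [] ≡⟨ eq [] ⟩
  eval g [] ≡⟨ eval-[] g ⟩
  g []      ∎
  where
  open ≡-Reasoning
  eval-[] : ∀ (f : 𝔹 0) → eval f [] ≡ f []
  eval-[] f = trans (eval-∑ f []) (trans (xor-identityʳ _) (∧-identityʳ _))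
eval-injective {suc N} {f} {g} eq = λ where
    (outside ∷ t) → eval-injective outside-eq t
    (inside ∷ t)  → eval-injective inside-eq t
  where
  open ≡-Reasoning
  outside-eq : ∀ a → eval (f ∘ (outside ∷_)) a ≡ eval (g ∘ (outside ∷_)) a
  outside-eq a = begin
    eval (f ∘ (outside ∷_)) a           ≡⟨ xor-identityʳ _ ⟨
    eval (f ∘ (outside ∷_)) a xor false ≡⟨ eval-∷ f false a ⟨
    eval f (false ∷ a)                  ≡⟨ eq (false ∷ a) ⟩
    eval g (false ∷ a)                  ≡⟨ eval-∷ g false a ⟩
    eval (g ∘ (outside ∷_)) a xor false ≡⟨ xor-identityʳ _ ⟩
    eval (g ∘ (outside ∷_)) a           ∎
  inside-eq : ∀ a → eval (f ∘ (inside ∷_)) a ≡ eval (g ∘ (inside ∷_)) a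
  inside-eq a = xor-cancelˡ (eval (f ∘ (outside ∷_)) a) (begin
    eval (f ∘ (outside ∷_)) a xor eval (f ∘ (inside ∷_)) a ≡⟨ eval-∷ f true a ⟨
    eval f (true ∷ a)                                      ≡⟨ eq (true ∷ a) ⟩
    eval g (true ∷ a)                                      ≡⟨ eval-∷ g true a ⟩
    eval (g ∘ (outside ∷_)) a xor eval (g ∘ (inside ∷_)) a ≡⟨ cong (_xor _) (outside-eq a) ⟨
    eval (f ∘ (outside ∷_)) a xor eval (g ∘ (inside ∷_)) a ∎)

-- Adding indeterminates and projecting points

weaken-∷ʳ : ∀ (f : 𝔹 N) t b → weaken f (t ∷ʳ b) ≡ (if b then false else f t)
weaken-∷ʳ f t b = cong₂ (λ b s → if b then false else f s) (Vec.last-∷ʳ b t) (Vec.init-∷ʳ b t)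

eval-weaken : ∀ (f : 𝔹 N) b → eval (weaken f) b ≡ eval f (init b)
eval-weaken {N} f b = begin
  eval (weaken f) b
    ≡⟨ cong (eval (weaken f)) (init-last b) ⟩
  eval (weaken f) (a ∷ʳ c)
    ≡⟨ eval-∑ (weaken f) (a ∷ʳ c) ⟩
  ∑ (terms (suc N)) (λ t → weaken f t ∧ evalTerm t (a ∷ʳ c))
    ≡⟨ ∑-terms-∷ʳ N (λ t → weaken f t ∧ evalTerm t (a ∷ʳ c)) ⟩
  ∑ (terms N) (λ t → weaken f (t ∷ʳ outside) ∧ evalTerm (t ∷ʳ outside) (a ∷ʳ c)) xor
  ∑ (terms N) (λ t → weaken f (t ∷ʳ inside) ∧ evalTerm (t ∷ʳ inside) (a ∷ʳ c))
    ≡⟨ cong₂ _xor_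
         (∑-cong (terms N) λ t → cong₂ _∧_ (weaken-∷ʳ f t outside)
                                           (trans (evalTerm-∷ʳ t outside a c) (∧-identityʳ _)))
         (trans (∑-cong (terms N) λ t → cong (_∧ evalTerm (t ∷ʳ inside) (a ∷ʳ c)) (weaken-∷ʳ f t inside))
                (∑-false (terms N))) ⟩
  ∑ (terms N) (λ t → f t ∧ evalTerm t a) xor false
    ≡⟨ xor-identityʳ _ ⟩
  ∑ (terms N) (λ t → f t ∧ evalTerm t a)
    ≡⟨ eval-∑ f a ⟨
  eval f a ∎
  where
  open ≡-Reasoning
  a = init b
  c = last b

monomial-injective : ∀ {s t : Term N} → monomial s ≈ monomial t → s ≡ t
monomial-injective {s = s} {t} eq = monomial-true s t (trans (eq t) (monomial-refl t))

project-zero : ∀ n (b : Vec Bool n) → project n 0 b ≡ b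
-- Truncation does not depend on the proof of the inequality, so the one built into `project` may be
-- replaced by reflexivity.
project-zero n b = trans (Vec.truncate-irrelevant _ ℕ.≤-refl b) (Vec.truncate-refl b)

truncate-init : ∀ {m k} (p : m ≤ suc k) (q : m ≤ k) (b : Vec A (suc k)) →
                truncate p b ≡ truncate q (init b)
truncate-init z≤n     z≤n     b       = refl
truncate-init (s≤s p) (s≤s q) (c ∷ b) = cong (c ∷_) (truncate-init p q b)

project-suc : ∀ n m (b : Vec Bool (suc (m + n))) → project n (suc m) b ≡ project n m (init b)
project-suc n m b = truncate-init (ℕ.m≤n+m n (suc m)) (ℕ.m≤n+m n m) b

eval-weaken* : ∀ m (f : 𝔹 n) b → eval (weaken* m f) b ≡ eval f (project n m b)
eval-weaken* {n} zero    f b = cong (eval f) (sym (project-zero n b))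
eval-weaken* {n} (suc m) f b = begin
  eval (weaken (weaken* m f)) b    ≡⟨ eval-weaken (weaken* m f) b ⟩
  eval (weaken* m f) (init b)      ≡⟨ eval-weaken* m f (init b) ⟩
  eval f (project n m (init b))    ≡⟨ cong (eval f) (project-suc n m b) ⟨
  eval f (project n (suc m) b)     ∎
  where open ≡-Reasoning

evalTerm-last : ∀ N (b : Vec Bool (suc N)) → evalTerm ⁅ fromℕ N ⁆ b ≡ last b
evalTerm-last zero    (c ∷ []) = ∧-identityʳ c
evalTerm-last (suc N) (_ ∷ b)  = evalTerm-last N b

eval-x-last : ∀ N (b : Vec Bool (suc N)) → eval (x (fromℕ N)) b ≡ last b
eval-x-last N b = trans (eval-monomial ⁅ fromℕ N ⁆ b) (evalTerm-last N b)

weaken-cong : ∀ {f g : 𝔹 N} → f ≈ g → weaken f ≈ weaken g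
weaken-cong f≈g t with last t
... | true  = refl
... | false = f≈g (init t)

weaken-⊗ : ∀ (f g : 𝔹 N) → weaken (f ⊗ g) ≈ weaken f ⊗ weaken g
weaken-⊗ f g = eval-injective λ b → begin
  eval (weaken (f ⊗ g)) b                        ≡⟨ eval-weaken (f ⊗ g) b ⟩
  eval (f ⊗ g) (init b)                          ≡⟨ eval-⊗ f g (init b) ⟩
  eval f (init b) ∧ eval g (init b)              ≡⟨ cong₂ _∧_ (eval-weaken f b) (eval-weaken g b) ⟨
  eval (weaken f) b ∧ eval (weaken g) b          ≡⟨ eval-⊗ (weaken f) (weaken g) b ⟨
  eval (weaken f ⊗ weaken g) b                   ∎
  where open ≡-Reasoning

weaken-monomial : ∀ (s : Term N) → weaken (monomial s) ≈ monomial (s ∷ʳ outside)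
weaken-monomial s = eval-injective λ b → begin
  eval (weaken (monomial s)) b               ≡⟨ eval-weaken (monomial s) b ⟩
  eval (monomial s) (init b)                 ≡⟨ eval-monomial s (init b) ⟩
  evalTerm s (init b)                        ≡⟨ ∧-identityʳ _ ⟨
  evalTerm s (init b) ∧ true                 ≡⟨ evalTerm-∷ʳ s outside (init b) (last b) ⟨
  evalTerm (s ∷ʳ outside) (init b ∷ʳ last b) ≡⟨ cong (evalTerm (s ∷ʳ outside)) (init-last b) ⟨
  evalTerm (s ∷ʳ outside) b                  ≡⟨ eval-monomial (s ∷ʳ outside) b ⟨
  eval (monomial (s ∷ʳ outside)) b           ∎
  where open ≡-Reasoning

monomial-⊗ : ∀ (s t : Term N) → monomial s ⊗ monomial t ≈ monomial (s ∪ t)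
monomial-⊗ s t = eval-injective λ a → begin
  eval (monomial s ⊗ monomial t) a          ≡⟨ eval-⊗ (monomial s) (monomial t) a ⟩
  eval (monomial s) a ∧ eval (monomial t) a ≡⟨ cong₂ _∧_ (eval-monomial s a) (eval-monomial t a) ⟩
  evalTerm s a ∧ evalTerm t a               ≡⟨ evalTerm-∪ s t a ⟨
  evalTerm (s ∪ t) a                        ≡⟨ eval-monomial (s ∪ t) a ⟨
  eval (monomial (s ∪ t)) a                 ∎
  where open ≡-Reasoning

weaken*-cong : ∀ m {f g : 𝔹 n} → f ≈ g → weaken* m f ≈ weaken* m g
weaken*-cong zero    f≈g = f≈g
weaken*-cong (suc m) f≈g = weaken-cong (weaken*-cong m f≈g)

weaken*-⊗ : ∀ m (f g : 𝔹 n) → weaken* m (f ⊗ g) ≈ weaken* m f ⊗ weaken* m g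
weaken*-⊗ zero    f g t = refl
weaken*-⊗ (suc m) f g t =
  trans (weaken-cong (weaken*-⊗ m f g) t) (weaken-⊗ (weaken* m f) (weaken* m g) t)

⊗-identityˡ : ∀ (f : 𝔹 N) → 1# ⊗ f ≈ f
⊗-identityˡ f = eval-injective λ a → trans (eval-⊗ 1# f a) (cong (_∧ eval f a) (eval-1# a))

∈⟨⟩-refl : ∀ (f : 𝔹 N) → ⟨ f ⟩ f
∈⟨⟩-refl f = 1# , sym ∘ ⊗-identityˡ f

-- Sizes of terms

∣∷ʳoutside∣ : ∀ (t : Term N) → ∣ t ∷ʳ outside ∣ ≡ ∣ t ∣
∣∷ʳoutside∣ []            = refl
∣∷ʳoutside∣ (outside ∷ t) = ∣∷ʳoutside∣ t
∣∷ʳoutside∣ (inside ∷ t)  = cong suc (∣∷ʳoutside∣ t)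

∣∪∣≤ : ∀ (s t : Term N) → ∣ s ∪ t ∣ ≤ ∣ s ∣ + ∣ t ∣
∣∪∣≤ []            []            = z≤n
∣∪∣≤ (outside ∷ s) (outside ∷ t) = ∣∪∣≤ s t
∣∪∣≤ (inside ∷ s)  (outside ∷ t) = s≤s (∣∪∣≤ s t)
∣∪∣≤ (outside ∷ s) (inside ∷ t)  =
  ℕ.≤-trans (s≤s (∣∪∣≤ s t)) (ℕ.≤-reflexive (sym (ℕ.+-suc ∣ s ∣ ∣ t ∣)))
∣∪∣≤ (inside ∷ s)  (inside ∷ t)  =
  s≤s (ℕ.≤-trans (∣∪∣≤ s t) (ℕ.+-monoʳ-≤ ∣ s ∣ (ℕ.n≤1+n ∣ t ∣)))

∣t∣≡0⇒t≡⊥ : ∀ (t : Term N) → ∣ t ∣ ≡ 0 → t ≡ ⊥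
∣t∣≡0⇒t≡⊥ []            _  = refl
∣t∣≡0⇒t≡⊥ (outside ∷ t) eq = cong (outside ∷_) (∣t∣≡0⇒t≡⊥ t eq)

-- Splits off the indeterminate of least index.
∣t∣≡suc⇒⁅i⁆∪s : ∀ (t : Term N) {k} → ∣ t ∣ ≡ suc k → ∃₂ λ i s → ∣ s ∣ ≡ k × t ≡ ⁅ i ⁆ ∪ s
∣t∣≡suc⇒⁅i⁆∪s (inside ∷ t)  eq =
  zero , outside ∷ t , ℕ.suc-injective eq , cong (inside ∷_) (sym (∪-identityˡ t))
∣t∣≡suc⇒⁅i⁆∪s (outside ∷ t) eq with i , s , ∣s∣ , t≡ ← ∣t∣≡suc⇒⁅i⁆∪s t eq =
  suc i , outside ∷ s , ∣s∣ , cong (outside ∷_) t≡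

∣t∣≡1⇒t≡⁅i⁆ : ∀ (t : Term N) → ∣ t ∣ ≡ 1 → ∃[ i ] t ≡ ⁅ i ⁆
∣t∣≡1⇒t≡⁅i⁆ t eq with i , s , ∣s∣≡0 , refl ← ∣t∣≡suc⇒⁅i⁆∪s t eq
                   with refl ← ∣t∣≡0⇒t≡⊥ s ∣s∣≡0 = i , ∪-identityʳ ⁅ i ⁆

-- The inequality supplies the distinct factors that a loop pass demands; equal singletons would
-- have a union of size 1.
∣t∣≡2⇒t≡⁅i⁆∪⁅j⁆ : ∀ (t : Term N) → ∣ t ∣ ≡ 2 → ∃₂ λ i j → ⁅ i ⁆ ≢ ⁅ j ⁆ × t ≡ ⁅ i ⁆ ∪ ⁅ j ⁆
∣t∣≡2⇒t≡⁅i⁆∪⁅j⁆ t eq with i , s , ∣s∣≡1 , refl ← ∣t∣≡suc⇒⁅i⁆∪s t eq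
                       with j , refl ← ∣t∣≡1⇒t≡⁅i⁆ s ∣s∣≡1 = i , j , distinct , refl
  where
  open ≡-Reasoning
  distinct : ⁅ i ⁆ ≢ ⁅ j ⁆
  distinct ⁅i⁆≡⁅j⁆ = ℕ.1+n≢n (begin
    2                 ≡⟨ eq ⟨
    ∣ ⁅ i ⁆ ∪ ⁅ j ⁆ ∣ ≡⟨ cong (λ s → ∣ ⁅ i ⁆ ∪ s ∣) ⁅i⁆≡⁅j⁆ ⟨
    ∣ ⁅ i ⁆ ∪ ⁅ i ⁆ ∣ ≡⟨ cong ∣_∣ (∪-idem ⁅ i ⁆) ⟩
    ∣ ⁅ i ⁆ ∣         ≡⟨ ∣⁅x⁆∣≡1 i ⟩
    1                 ∎)

-- Degrees

-- A bound on every term of the support passes through sums, products and `weaken` directly, unlike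
-- the maximum in `deg`. For bound 1 it replaces `Linear`, to which it is equivalent.
DegreeAtMost : ℕ → 𝔹 N → Set
DegreeAtMost d f = ∀ t → f t ≡ true → ∣ t ∣ ≤ d

∈-Supp⁺ : ∀ (f : 𝔹 N) {t} → f t ≡ true → t ∈ Supp f
∈-Supp⁺ f {t} = ∈-filter⁺ (λ t → f t Bool.≟ true) (terms-complete t)

∈-Supp⁻ : ∀ (f : 𝔹 N) {t} → t ∈ Supp f → f t ≡ true
∈-Supp⁻ {N} f t∈ = proj₂ (∈-filter⁻ (λ t → f t Bool.≟ true) {xs = terms N} t∈)

deg≤⇒DegreeAtMost : ∀ (f : 𝔹 N) → deg f ≤ d → DegreeAtMost d f
deg≤⇒DegreeAtMost f deg≤d t ft =
  ℕ.≤-trans (All.lookup (xs≤max 0 (List.map ∣_∣ (Supp f))) (∈-map⁺ ∣_∣ (∈-Supp⁺ f ft))) deg≤d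

DegreeAtMost⇒deg≤ : ∀ (f : 𝔹 N) → DegreeAtMost d f → deg f ≤ d
DegreeAtMost⇒deg≤ f bound =
  f[argmax]≤v⁺ {f = id} {⊥ = 0} {xs = List.map ∣_∣ (Supp f)} z≤n
    (All.map⁺ (All.tabulate λ t∈ → bound _ (∈-Supp⁻ f t∈)))

deg-attained : ∀ (f : 𝔹 N) → deg f ≡ suc d → ∃[ t ] f t ≡ true × ∣ t ∣ ≡ suc d
deg-attained f eq with argmax-sel id 0 (List.map ∣_∣ (Supp f))
-- The maximum may also be its default value 0, which a successor degree rules out.
... | inj₁ deg≡0 with () ← trans (sym eq) deg≡0
... | inj₂ deg∈ with t , t∈ , deg≡∣t∣ ← ∈-map⁻ ∣_∣ deg∈ =
  t , ∈-Supp⁻ f t∈ , trans (sym deg≡∣t∣) eq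

xor-true : ∀ a b → a xor b ≡ true → a ≡ true ⊎ b ≡ true
xor-true true  b eq = inj₁ refl
xor-true false b eq = inj₂ eq

DegreeAtMost-mono : ∀ {f : 𝔹 N} → d ≤ d′ → DegreeAtMost d f → DegreeAtMost d′ f
DegreeAtMost-mono d≤d′ bound t ft = ℕ.≤-trans (bound t ft) d≤d′

DegreeAtMost-resp-≈ : ∀ {f g : 𝔹 N} → f ≈ g → DegreeAtMost d f → DegreeAtMost d g
DegreeAtMost-resp-≈ f≈g bound t gt = bound t (trans (f≈g t) gt)

DegreeAtMost-⊕ : ∀ {f g : 𝔹 N} → DegreeAtMost d f → DegreeAtMost d g → DegreeAtMost d (f ⊕ g)
DegreeAtMost-⊕ {f = f} {g} fb gb t eq with xor-true (f t) (g t) eq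
... | inj₁ ft = fb t ft
... | inj₂ gt = gb t gt

-- A sum with value `true` has a summand with value `true`. Hence every term of the product's
-- support is a union `s ∪ t` of terms from the two supports.
DegreeAtMost-⊗ : ∀ {f g : 𝔹 N} → DegreeAtMost d f → DegreeAtMost d′ g → DegreeAtMost (d + d′) (f ⊗ g)
DegreeAtMost-⊗ {N} {f = f} {g} fb gb u eq
  with s , eqₛ ← ∑-true (terms N) _ eq
  with t , eqₜ ← ∑-true (terms N) _ eqₛ
  with refl ← monomial-true (s ∪ t) u (∧-conicalˡ _ _ eqₜ)
  with fg ← ∧-conicalʳ (monomial (s ∪ t) u) _ eqₜ =
  ℕ.≤-trans (∣∪∣≤ s t)
    (ℕ.+-mono-≤ (fb s (∧-conicalˡ (f s) _ fg)) (gb t (∧-conicalʳ (f s) _ fg)))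

DegreeAtMost-monomial : ∀ (s : Term N) → DegreeAtMost ∣ s ∣ (monomial s)
DegreeAtMost-monomial s t eq with refl ← monomial-true s t eq = ℕ.≤-refl

DegreeAtMost-1# : DegreeAtMost {N} d 1#
DegreeAtMost-1# {N} =
  DegreeAtMost-mono (ℕ.≤-trans (ℕ.≤-reflexive (∣⊥∣≡0 N)) z≤n) (DegreeAtMost-monomial ⊥)

DegreeAtMost-x : ∀ (i : Fin N) → DegreeAtMost 1 (x i)
DegreeAtMost-x i =
  DegreeAtMost-mono (ℕ.≤-reflexive (∣⁅x⁆∣≡1 i)) (DegreeAtMost-monomial ⁅ i ⁆)

weaken-true : ∀ (f : 𝔹 N) t → weaken f t ≡ true → f (init t) ≡ true × t ≡ init t ∷ʳ outside
weaken-true f t eq with last t | init-last t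
... | false | t≡ = eq , t≡

DegreeAtMost-weaken : ∀ {f : 𝔹 N} → DegreeAtMost d f → DegreeAtMost d (weaken f)
DegreeAtMost-weaken {f = f} bound t eq with ft , t≡ ← weaken-true f t eq =
  ℕ.≤-trans (ℕ.≤-reflexive (trans (cong ∣_∣ t≡) (∣∷ʳoutside∣ (init t)))) (bound (init t) ft)

DegreeAtMost-weaken* : ∀ m {f : 𝔹 n} → DegreeAtMost d f → DegreeAtMost d (weaken* m f)
DegreeAtMost-weaken* zero    bound = bound
DegreeAtMost-weaken* (suc m) bound = DegreeAtMost-weaken (DegreeAtMost-weaken* m bound)

foldr-⊕ : ∀ (is : List A) (F : A → 𝔹 N) t →
          List.foldr _⊕_ 0# (List.map F is) t ≡ ∑ is (λ i → F i t)
foldr-⊕ []       F t = refl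
foldr-⊕ (i ∷ is) F t = cong (F i t xor_) (foldr-⊕ is F t)

Linear⇒DegreeAtMost : ∀ {f : 𝔹 N} → Linear f → DegreeAtMost 1 f
Linear⇒DegreeAtMost {N} (c₀ , c , f≈) t ft
  with xor-true (c₀ ∧ 1# t) _ (trans (sym (f≈ t)) ft)
... | inj₁ eq = DegreeAtMost-1# t (∧-conicalʳ c₀ _ eq)
... | inj₂ eq
  with i , eqᵢ ← ∑-true (allFin N) _ (trans (sym (foldr-⊕ (allFin N) (λ i → c i · x i) t)) eq) =
  DegreeAtMost-x i t (∧-conicalʳ (c i) _ eqᵢ)

∧-falseʳ : ∀ c {d} → d ≡ false → c ∧ d ≡ false
∧-falseʳ c refl = ∧-zeroʳ c

⁅⁆-injective : ∀ (i j : Fin N) → ⁅ i ⁆ ≡ ⁅ j ⁆ → i ≡ j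
⁅⁆-injective i j eq = x∈⁅y⁆⇒x≡y j (subst (i Subset.∈_) eq (x∈⁅x⁆ i))

-- The coefficients are those of `f` at the empty term and at the singletons. Compared at a term
-- `t`, only the constant contributes for size 0, only one singleton for size 1, and nothing on
-- either side for size at least 2.
DegreeAtMost⇒Linear : ∀ {f : 𝔹 N} → DegreeAtMost 1 f → Linear f
DegreeAtMost⇒Linear {N} {f} bound = f ⊥ , c , λ t →
  trans (expand t) (cong ((f ⊥ ∧ 1# t) xor_) (sym (foldr-⊕ (allFin N) (λ i → c i · x i) t)))
  where
  open ≡-Reasoning
  c : Fin N → Bool
  c i = f ⁅ i ⁆
  singletons-vanish : ∀ {t} → ∣ t ∣ ≢ 1 → ∑ (allFin N) (λ i → c i ∧ x i t) ≡ false
  singletons-vanish {t} ∣t∣≢1 = ∑-vanishing {xs = allFin N} {λ i → c i ∧ x i t} (All.tabulate λ {i} _ →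
    ∧-falseʳ (c i) (monomial-≢ {s = ⁅ i ⁆} {t} λ where refl → ∣t∣≢1 (∣⁅x⁆∣≡1 i)))
  constant-vanishes : ∀ {t} → ∣ t ∣ ≢ 0 → f ⊥ ∧ 1# t ≡ false
  constant-vanishes {t} ∣t∣≢0 = ∧-falseʳ (f ⊥) (monomial-≢ {s = ⊥} {t} λ where refl → ∣t∣≢0 (∣⊥∣≡0 N))
  expand : ∀ t → f t ≡ (f ⊥ ∧ 1# t) xor ∑ (allFin N) (λ i → c i ∧ x i t)
  expand t with ∣ t ∣ in ∣t∣≡
  ... | 0 with refl ← ∣t∣≡0⇒t≡⊥ t ∣t∣≡ = begin
    f ⊥                                                     ≡⟨ ∧-identityʳ (f ⊥) ⟨
    f ⊥ ∧ true                                              ≡⟨ cong (f ⊥ ∧_) (monomial-refl {N} ⊥) ⟨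
    f ⊥ ∧ 1# {N} ⊥                                          ≡⟨ xor-identityʳ _ ⟨
    (f ⊥ ∧ 1# {N} ⊥) xor false
      ≡⟨ cong ((f ⊥ ∧ 1# {N} ⊥) xor_) (singletons-vanish λ ∣⊥∣≡1 → ℕ.0≢1+n (trans (sym ∣t∣≡) ∣⊥∣≡1)) ⟨
    (f ⊥ ∧ 1# {N} ⊥) xor ∑ (allFin N) (λ i → c i ∧ x i ⊥)  ∎
  ... | 1 with j , refl ← ∣t∣≡1⇒t≡⁅i⁆ t ∣t∣≡ = begin
    f ⁅ j ⁆                                         ≡⟨ ∧-identityʳ _ ⟨
    c j ∧ true                                      ≡⟨ cong (c j ∧_) (monomial-refl ⁅ j ⁆) ⟨
    c j ∧ x j ⁅ j ⁆                                 ≡⟨ ∑-single (Unique.allFin⁺ N) (∈-allFin j) other ⟨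
    ∑ (allFin N) (λ i → c i ∧ x i ⁅ j ⁆)
      ≡⟨ cong (_xor ∑ (allFin N) (λ i → c i ∧ x i ⁅ j ⁆))
              (constant-vanishes {⁅ j ⁆} λ ∣t∣≡0 → ℕ.0≢1+n (trans (sym ∣t∣≡0) ∣t∣≡)) ⟨
    (f ⊥ ∧ 1# ⁅ j ⁆) xor ∑ (allFin N) (λ i → c i ∧ x i ⁅ j ⁆) ∎
    where
    other : ∀ {i} → j ≢ i → c i ∧ x i ⁅ j ⁆ ≡ false
    other {i} j≢i = ∧-falseʳ (c i) (monomial-≢ (j≢i ∘ sym ∘ ⁅⁆-injective i j))
  ... | suc (suc k) = begin
    f t     ≡⟨ ¬-not (λ ft → ℕ.<⇒≱ (s≤s (s≤s z≤n)) (subst (_≤ 1) ∣t∣≡ (bound t ft))) ⟩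
    false   ≡⟨ cong₂ _xor_ (constant-vanishes {t} λ ∣t∣≡0 → ℕ.0≢1+n (trans (sym ∣t∣≡0) ∣t∣≡))
                           (singletons-vanish {t} λ ∣t∣≡1 →
                              ℕ.0≢1+n (ℕ.suc-injective (trans (sym ∣t∣≡1) ∣t∣≡))) ⟨
    (f ⊥ ∧ 1# t) xor ∑ (allFin N) (λ i → c i ∧ x i t) ∎

-- Counting non-linear terms

-- #nonLinearTerms f is #heavy ∣_∣ f (terms N) definitionally; an arbitrary size
-- function allows reindexing the list of terms.
#heavy : (A → ℕ) → (A → Bool) → List A → ℕ
#heavy σ p xs = length (List.filter (λ a → 2 ≤? σ a) (List.filter (λ a → p a Bool.≟ true) xs))

-- The contribution of a single element: it presents the length of a doubly filtered list as a sum,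
-- which can be compared element by element.
weight : (A → ℕ) → (A → Bool) → A → ℕ
weight σ p a = if p a ∧ does (2 ≤? σ a) then 1 else 0

#heavy-∷ : ∀ (σ : A → ℕ) p a xs →
           #heavy σ p (a ∷ xs) ≡ weight σ p a + #heavy σ p xs
#heavy-∷ σ p a xs with p a
... | false = refl
... | true with does (2 ≤? σ a)
...   | false = refl
...   | true  = refl

#heavy-map : ∀ (φ : A → B) {σ : B → ℕ} {τ : A → ℕ} {p : B → Bool} {q : A → Bool} →
             (∀ a → σ (φ a) ≡ τ a) → (∀ a → p (φ a) ≡ q a) →
             ∀ xs → #heavy σ p (List.map φ xs) ≡ #heavy τ q xs
#heavy-map φ σ≡τ p≡q [] = refl
#heavy-map φ {σ} {τ} {p} {q} σ≡τ p≡q (a ∷ xs)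
  rewrite #heavy-∷ σ p (φ a) (List.map φ xs) | #heavy-∷ τ q a xs | σ≡τ a | p≡q a =
  cong (_ +_) (#heavy-map φ σ≡τ p≡q xs)

#heavy-++ : ∀ (σ : A → ℕ) p xs ys → #heavy σ p (xs ++ ys) ≡ #heavy σ p xs + #heavy σ p ys
#heavy-++ σ p []       ys = refl
#heavy-++ σ p (a ∷ xs) ys
  rewrite #heavy-∷ σ p a (xs ++ ys) | #heavy-∷ σ p a xs | #heavy-++ σ p xs ys =
  sym (ℕ.+-assoc (weight σ p a) _ _)

#heavy-↭ : ∀ (σ : A → ℕ) p {xs ys} → xs ↭ ys → #heavy σ p xs ≡ #heavy σ p ys
#heavy-↭ σ p = ↭-length ∘ filter-↭ _ ∘ filter-↭ _

#heavy-false : ∀ (σ : A → ℕ) xs → #heavy σ (λ _ → false) xs ≡ 0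
#heavy-false σ []       = refl
#heavy-false σ (_ ∷ xs) = #heavy-false σ xs

module _ (σ : A → ℕ) {p q : A → Bool} (p⇒q : ∀ {a} → 2 ≤ σ a → p a ≡ true → q a ≡ true) where

  -- The implication from `p` to `q` is asked for only at elements of size at least 2. This is what
  -- allows linear terms to be added without raising the count.
  weight-mono : ∀ a → weight σ p a ≤ weight σ q a
  weight-mono a with p a in pa | 2 ≤? σ a
  ... | false | _      = z≤n
  ... | true  | no 2≰  rewrite dec-false (2 ≤? σ a) 2≰ = z≤n
  ... | true  | yes 2≤ rewrite p⇒q 2≤ pa = ℕ.≤-refl

  #heavy-mono : ∀ xs → #heavy σ p xs ≤ #heavy σ q xs
  #heavy-mono []       = z≤n
  #heavy-mono (a ∷ xs) rewrite #heavy-∷ σ p a xs | #heavy-∷ σ q a xs =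
    ℕ.+-mono-≤ (weight-mono a) (#heavy-mono xs)

  #heavy-mono-< : ∀ {a xs} → a ∈ xs → 2 ≤ σ a → p a ≡ false → q a ≡ true →
                  #heavy σ p xs < #heavy σ q xs
  #heavy-mono-< {a} {_ ∷ xs} (here refl) 2≤ pa qa
    rewrite #heavy-∷ σ p a xs | #heavy-∷ σ q a xs | pa | qa | dec-true (2 ≤? σ a) 2≤ =
    s≤s (#heavy-mono xs)
  #heavy-mono-< {a} {b ∷ xs} (there a∈) 2≤ pa qa
    rewrite #heavy-∷ σ p b xs | #heavy-∷ σ q b xs =
    ℕ.+-mono-≤-< (weight-mono b) (#heavy-mono-< a∈ 2≤ pa qa)

-- Terms are grouped by the last indeterminate: those without it keep their size and coefficient.
#nonLinearTerms-weaken : ∀ (f : 𝔹 N) → #nonLinearTerms (weaken f) ≡ #nonLinearTerms f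
#nonLinearTerms-weaken {N} f = begin
  count (terms (suc N))
    ≡⟨ #heavy-↭ ∣_∣ (weaken f) (terms-∷ʳ N) ⟩
  count (List.map (_∷ʳ outside) (terms N) ++ List.map (_∷ʳ inside) (terms N))
    ≡⟨ #heavy-++ ∣_∣ (weaken f) (List.map _ (terms N)) _ ⟩
  count (List.map (_∷ʳ outside) (terms N)) + count (List.map (_∷ʳ inside) (terms N))
    ≡⟨ cong₂ _+_ (#heavy-map (_∷ʳ outside) ∣∷ʳoutside∣ (λ t → weaken-∷ʳ f t outside) (terms N))
                 -- Terms containing the new indeterminate have coefficient `false`, so their sizes
                 -- are left unevaluated.
                 (#heavy-map (_∷ʳ inside) (λ _ → refl) (λ t → weaken-∷ʳ f t inside) (terms N)) ⟩
  #nonLinearTerms f + #heavy (λ t → ∣ t ∷ʳ inside ∣) (λ _ → false) (terms N)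
    ≡⟨ cong (#nonLinearTerms f +_) (#heavy-false _ (terms N)) ⟩
  #nonLinearTerms f + 0
    ≡⟨ ℕ.+-identityʳ _ ⟩
  #nonLinearTerms f ∎
  where
  open ≡-Reasoning
  count : List (Term (suc N)) → ℕ
  count = #heavy ∣_∣ (weaken f)

#nonLinearTerms-linear-⊕ : ∀ {ℓ : 𝔹 N} → DegreeAtMost 1 ℓ → ∀ g →
                           #nonLinearTerms (ℓ ⊕ g) ≤ #nonLinearTerms g
#nonLinearTerms-linear-⊕ {N} {ℓ} bound g = #heavy-mono ∣_∣ implies (terms N)
  where
  implies : ∀ {t} → 2 ≤ ∣ t ∣ → ℓ t xor g t ≡ true → g t ≡ true
  implies {t} 2≤ eq with xor-true (ℓ t) (g t) eq
  ... | inj₁ ℓt = contradiction (bound t ℓt) (ℕ.<⇒≱ 2≤)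
  ... | inj₂ gt = gt

-- Termination

⟶-decreasing : ∀ {s s′ : State n} → s ⟶ s′ →
               #nonLinearTerms (State.f s′) < #nonLinearTerms (State.f s)
⟶-decreasing {n} (step {i} _ _ _ f′ _ _ _ _ less) =
  ℕ.≤-<-trans (ℕ.≤-trans (#nonLinearTerms-linear-⊕ (DegreeAtMost-x (fromℕ (i + n))) (weaken f′))
                         (ℕ.≤-reflexive (#nonLinearTerms-weaken f′)))
              less

-- With the relation flipped, accessibility descends along transitions, so it excludes infinite runs
-- under every sequence of choices.
⟶-wellFounded : WellFounded (flip (_⟶_ {n}))
⟶-wellFounded = Subrelation.wellFounded ⟶-decreasing
  (On.wellFounded (#nonLinearTerms ∘ State.f) <-wellFounded)

-- The loop invariant

-- The factors are kept with the product, since the final representation has to exhibit them; `≈` is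
-- used because `weaken` commutes with `⊗` only up to `≈`.
ProductOfLinears : 𝔹 N → Set
ProductOfLinears p = ∃₂ λ g h → DegreeAtMost 1 g × DegreeAtMost 1 h × p ≈ g ⊗ h

ProductOfLinears-weaken : ∀ {p : 𝔹 N} → ProductOfLinears p → ProductOfLinears (weaken p)
ProductOfLinears-weaken (g , h , g-lin , h-lin , p≈) =
  weaken g , weaken h , DegreeAtMost-weaken g-lin , DegreeAtMost-weaken h-lin ,
  λ t → trans (weaken-cong p≈ t) (weaken-⊗ g h t)

Vanishes : Vec Bool N → 𝔹 N → Set
Vanishes b p = eval p b ≡ false

-- The last four fields say that the zeros of M are the graph of a function of
-- the original point, on which f agrees with f₀.
record Invariant (f₀ : 𝔹 n) (s : State n) : Set where
  open State s
  field
    quadratic        : 𝔹 n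
    linear           : 𝔹 (i + n)
    quadratic-degree : DegreeAtMost 2 quadratic
    linear-degree    : DegreeAtMost 1 linear
    split            : f ≈ weaken* i quadratic ⊕ linear
    products         : All ProductOfLinears M
    lift             : Vec Bool n → Vec Bool (i + n)
    project-lift     : ∀ a → project n i (lift a) ≡ a
    lift-vanishes    : ∀ a → All (Vanishes (lift a)) M
    lift-unique      : ∀ b → All (Vanishes b) M → b ≡ lift (project n i b)
    eval-lift        : ∀ a → eval f (lift a) ≡ eval f₀ a

start-invariant : ∀ {f : 𝔹 n} → DegreeAtMost 2 f → Invariant f (start f)
start-invariant {n} {f} bound = record
  { quadratic        = f
  ; linear           = 0#
  ; quadratic-degree = bound
  ; linear-degree    = λ _ ()
  ; split            = λ t → sym (xor-identityʳ (f t))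
  ; products         = []
  ; lift             = id
  ; project-lift     = project-zero n
  ; lift-vanishes    = λ _ → []
  ; lift-unique      = λ b _ → sym (project-zero n b)
  ; eval-lift        = λ _ → refl
  }

-- Preservation of the invariant by a loop pass

gate-zeros : ∀ y l₁ l₂ → y ∧ (l₂ xor true) ≡ false → l₂ ∧ (l₁ xor y) ≡ false → y ≡ l₁ ∧ l₂
gate-zeros false false _     _  _  = refl
gate-zeros false true  false _  _  = refl
gate-zeros true  true  true  _  _  = refl
gate-zeros false true  true  _  ()
gate-zeros true  _     false () _
gate-zeros true  false true  _  ()

gate-vanishes₁ : ∀ l₁ l₂ → (l₁ ∧ l₂) ∧ (l₂ xor true) ≡ false
gate-vanishes₁ true  true  = refl
gate-vanishes₁ true  false = refl
gate-vanishes₁ false _     = refl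

gate-vanishes₂ : ∀ l₁ l₂ → l₂ ∧ (l₁ xor (l₁ ∧ l₂)) ≡ false
gate-vanishes₂ true  true  = refl
gate-vanishes₂ false true  = refl
gate-vanishes₂ _     false = refl

xor-solve : ∀ a b {c} → a xor b ≡ c → b ≡ a xor c
xor-solve false b refl = refl
xor-solve true  b refl = sym (Bool.not-involutive b)

-- The lift of a point is extended by the value of `ℓ₁ℓ₂` there, the one value of `y` at which both
-- new products vanish. There `y + f′` takes the value of `ℓ₁ℓ₂ + f′`, which is the old `f`.
step-invariant : ∀ {f₀ : 𝔹 n} {s s′} → s ⟶ s′ → Invariant f₀ s → Invariant f₀ s′
step-invariant {n} {f₀} (step {i} {M} {f} _ ℓ₁ ℓ₂ f′ ℓ₁-linear ℓ₂-linear _ f≈ _) inv = record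
  { quadratic        = ℓ₁ ⊗ ℓ₂ ⊕ quadratic
  ; linear           = y ⊕ weaken linear
  ; quadratic-degree = DegreeAtMost-⊕ (DegreeAtMost-⊗ ℓ₁-degree ℓ₂-degree) quadratic-degree
  ; linear-degree    = DegreeAtMost-⊕ y-degree (DegreeAtMost-weaken linear-degree)
  ; split            = eval-injective split′
  ; products         = (y , L₂ ⊕ 1# , y-degree
                       , DegreeAtMost-⊕ (L-degree ℓ₂-degree) DegreeAtMost-1# , λ _ → refl)
                     ∷ (L₂ , L₁ ⊕ y , L-degree ℓ₂-degree
                       , DegreeAtMost-⊕ (L-degree ℓ₁-degree) y-degree , λ _ → refl)
                     ∷ All.map⁺ (All.map ProductOfLinears-weaken products)
  ; lift             = lift′
  ; project-lift     = project-lift′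
  ; lift-vanishes    = λ a → gate₁-vanishes a ∷ gate₂-vanishes a
                           ∷ All.map⁺ (All.map (weaken-vanishes a) (lift-vanishes a))
  ; lift-unique      = λ where b (gate₁ ∷ gate₂ ∷ rest) → lift-unique′ b gate₁ gate₂ (All.map⁻ rest)
  ; eval-lift        = eval-lift′
  }
  where
  open Invariant inv
  open ≡-Reasoning
  open xor-∧-Solver

  y L₁ L₂ : 𝔹 (suc i + n)
  y  = x (fromℕ (i + n))
  L₁ = weaken* (suc i) ℓ₁
  L₂ = weaken* (suc i) ℓ₂

  ℓ₁-degree = Linear⇒DegreeAtMost ℓ₁-linear
  ℓ₂-degree = Linear⇒DegreeAtMost ℓ₂-linear

  y-degree : DegreeAtMost 1 y
  y-degree = DegreeAtMost-x (fromℕ (i + n))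

  L-degree : ∀ {ℓ} → DegreeAtMost 1 ℓ → DegreeAtMost 1 (weaken* (suc i) ℓ)
  L-degree = DegreeAtMost-weaken* (suc i)

  eval-y⊕weaken : ∀ g b → eval (y ⊕ weaken g) b ≡ last b xor eval g (init b)
  eval-y⊕weaken g b =
    trans (eval-⊕ y (weaken g) b) (cong₂ _xor_ (eval-x-last (i + n) b) (eval-weaken g b))

  eval-f : ∀ b → eval f b ≡ (eval ℓ₁ (project n i b) ∧ eval ℓ₂ (project n i b)) xor eval f′ b
  eval-f b = begin
    eval f b
      ≡⟨ eval-cong f≈ b ⟩
    eval (weaken* i ℓ₁ ⊗ weaken* i ℓ₂ ⊕ f′) b
      ≡⟨ eval-⊕ (weaken* i ℓ₁ ⊗ weaken* i ℓ₂) f′ b ⟩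
    eval (weaken* i ℓ₁ ⊗ weaken* i ℓ₂) b xor eval f′ b
      ≡⟨ cong (_xor eval f′ b) (eval-⊗ (weaken* i ℓ₁) (weaken* i ℓ₂) b) ⟩
    (eval (weaken* i ℓ₁) b ∧ eval (weaken* i ℓ₂) b) xor eval f′ b
      ≡⟨ cong (_xor eval f′ b) (cong₂ _∧_ (eval-weaken* i ℓ₁ b) (eval-weaken* i ℓ₂ b)) ⟩
    (eval ℓ₁ (project n i b) ∧ eval ℓ₂ (project n i b)) xor eval f′ b ∎

  eval-f-split : ∀ b → eval f b ≡ eval quadratic (project n i b) xor eval linear b
  eval-f-split b = begin
    eval f b                                                ≡⟨ eval-cong split b ⟩
    eval (weaken* i quadratic ⊕ linear) b                   ≡⟨ eval-⊕ (weaken* i quadratic) linear b ⟩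
    eval (weaken* i quadratic) b xor eval linear b          ≡⟨ cong (_xor eval linear b)
                                                                 (eval-weaken* i quadratic b) ⟩
    eval quadratic (project n i b) xor eval linear b        ∎

  split′ : ∀ b → eval (y ⊕ weaken f′) b ≡
                 eval (weaken* (suc i) (ℓ₁ ⊗ ℓ₂ ⊕ quadratic) ⊕ (y ⊕ weaken linear)) b
  split′ b = begin
    eval (y ⊕ weaken f′) b
      ≡⟨ eval-y⊕weaken f′ b ⟩
    last b xor eval f′ c
      -- The transition and the invariant each express `f` at `c`; equating the two and moving
      -- `ℓ₁ℓ₂` across gives the value of `f′`.
      ≡⟨ cong (last b xor_) (xor-solve (eval ℓ₁ a ∧ eval ℓ₂ a) _
                                  (trans (sym (eval-f c)) (eval-f-split c))) ⟩
    last b xor ((eval ℓ₁ a ∧ eval ℓ₂ a) xor (eval quadratic a xor eval linear c))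
      ≡⟨ solve 4 (λ y p q l → y :+ (p :+ (q :+ l)) := (p :+ q) :+ (y :+ l)) refl
           (last b) (eval ℓ₁ a ∧ eval ℓ₂ a) (eval quadratic a) (eval linear c) ⟩
    ((eval ℓ₁ a ∧ eval ℓ₂ a) xor eval quadratic a) xor (last b xor eval linear c)
      ≡⟨ cong₂ _xor_ eval-quadratic′ (eval-y⊕weaken linear b) ⟨
    eval (weaken* (suc i) (ℓ₁ ⊗ ℓ₂ ⊕ quadratic)) b xor eval (y ⊕ weaken linear) b
      ≡⟨ eval-⊕ (weaken* (suc i) (ℓ₁ ⊗ ℓ₂ ⊕ quadratic)) (y ⊕ weaken linear) b ⟨
    eval (weaken* (suc i) (ℓ₁ ⊗ ℓ₂ ⊕ quadratic) ⊕ (y ⊕ weaken linear)) b ∎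
    where
    c = init b
    a = project n i c
    eval-quadratic′ : eval (weaken* (suc i) (ℓ₁ ⊗ ℓ₂ ⊕ quadratic)) b ≡
                      (eval ℓ₁ a ∧ eval ℓ₂ a) xor eval quadratic a
    eval-quadratic′ = begin
      eval (weaken* (suc i) (ℓ₁ ⊗ ℓ₂ ⊕ quadratic)) b
        ≡⟨ eval-weaken* (suc i) (ℓ₁ ⊗ ℓ₂ ⊕ quadratic) b ⟩
      eval (ℓ₁ ⊗ ℓ₂ ⊕ quadratic) (project n (suc i) b)
        ≡⟨ cong (eval (ℓ₁ ⊗ ℓ₂ ⊕ quadratic)) (project-suc n i b) ⟩
      eval (ℓ₁ ⊗ ℓ₂ ⊕ quadratic) a
        ≡⟨ eval-⊕ (ℓ₁ ⊗ ℓ₂) quadratic a ⟩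
      eval (ℓ₁ ⊗ ℓ₂) a xor eval quadratic a
        ≡⟨ cong (_xor eval quadratic a) (eval-⊗ ℓ₁ ℓ₂ a) ⟩
      (eval ℓ₁ a ∧ eval ℓ₂ a) xor eval quadratic a ∎

  lift′ : Vec Bool n → Vec Bool (suc i + n)
  lift′ a = lift a ∷ʳ (eval ℓ₁ a ∧ eval ℓ₂ a)

  init-lift′ : ∀ a → init (lift′ a) ≡ lift a
  init-lift′ a = Vec.init-∷ʳ _ (lift a)

  last-lift′ : ∀ a → last (lift′ a) ≡ eval ℓ₁ a ∧ eval ℓ₂ a
  last-lift′ a = Vec.last-∷ʳ _ (lift a)

  project-lift′ : ∀ a → project n (suc i) (lift′ a) ≡ a
  project-lift′ a = begin
    project n (suc i) (lift′ a)    ≡⟨ project-suc n i (lift′ a) ⟩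
    project n i (init (lift′ a))   ≡⟨ cong (project n i) (init-lift′ a) ⟩
    project n i (lift a)           ≡⟨ project-lift a ⟩
    a                              ∎

  eval-gate₁ : ∀ b → eval (y ⊗ (L₂ ⊕ 1#)) b ≡ last b ∧ (eval ℓ₂ (project n (suc i) b) xor true)
  eval-gate₁ b = begin
    eval (y ⊗ (L₂ ⊕ 1#)) b                                ≡⟨ eval-⊗ y (L₂ ⊕ 1#) b ⟩
    eval y b ∧ eval (L₂ ⊕ 1#) b                           ≡⟨ cong (eval y b ∧_) (eval-⊕ L₂ 1# b) ⟩
    eval y b ∧ (eval L₂ b xor eval 1# b)                  ≡⟨ cong₂ _∧_ (eval-x-last (i + n) b)
                                                               (cong₂ _xor_ (eval-weaken* (suc i) ℓ₂ b)
                                                                            (eval-1# b)) ⟩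
    last b ∧ (eval ℓ₂ (project n (suc i) b) xor true)     ∎

  eval-gate₂ : ∀ b → eval (L₂ ⊗ (L₁ ⊕ y)) b ≡
                     eval ℓ₂ (project n (suc i) b) ∧ (eval ℓ₁ (project n (suc i) b) xor last b)
  eval-gate₂ b = begin
    eval (L₂ ⊗ (L₁ ⊕ y)) b                ≡⟨ eval-⊗ L₂ (L₁ ⊕ y) b ⟩
    eval L₂ b ∧ eval (L₁ ⊕ y) b           ≡⟨ cong (eval L₂ b ∧_) (eval-⊕ L₁ y b) ⟩
    eval L₂ b ∧ (eval L₁ b xor eval y b)  ≡⟨ cong₂ _∧_ (eval-weaken* (suc i) ℓ₂ b)
                                               (cong₂ _xor_ (eval-weaken* (suc i) ℓ₁ b)
                                                            (eval-x-last (i + n) b)) ⟩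
    eval ℓ₂ (project n (suc i) b) ∧ (eval ℓ₁ (project n (suc i) b) xor last b) ∎

  gate₁-vanishes : ∀ a → Vanishes (lift′ a) (y ⊗ (L₂ ⊕ 1#))
  gate₁-vanishes a = begin
    eval (y ⊗ (L₂ ⊕ 1#)) (lift′ a)
      ≡⟨ eval-gate₁ (lift′ a) ⟩
    last (lift′ a) ∧ (eval ℓ₂ (project n (suc i) (lift′ a)) xor true)
      ≡⟨ cong₂ (λ c a → c ∧ (eval ℓ₂ a xor true)) (last-lift′ a) (project-lift′ a) ⟩
    (eval ℓ₁ a ∧ eval ℓ₂ a) ∧ (eval ℓ₂ a xor true)
      ≡⟨ gate-vanishes₁ (eval ℓ₁ a) (eval ℓ₂ a) ⟩
    false ∎

  gate₂-vanishes : ∀ a → Vanishes (lift′ a) (L₂ ⊗ (L₁ ⊕ y))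
  gate₂-vanishes a = begin
    eval (L₂ ⊗ (L₁ ⊕ y)) (lift′ a)
      ≡⟨ eval-gate₂ (lift′ a) ⟩
    eval ℓ₂ (project n (suc i) (lift′ a)) ∧ (eval ℓ₁ (project n (suc i) (lift′ a)) xor last (lift′ a))
      ≡⟨ cong₂ (λ c a → eval ℓ₂ a ∧ (eval ℓ₁ a xor c)) (last-lift′ a) (project-lift′ a) ⟩
    eval ℓ₂ a ∧ (eval ℓ₁ a xor (eval ℓ₁ a ∧ eval ℓ₂ a))
      ≡⟨ gate-vanishes₂ (eval ℓ₁ a) (eval ℓ₂ a) ⟩
    false ∎

  weaken-vanishes : ∀ a {p} → Vanishes (lift a) p → Vanishes (lift′ a) (weaken p)
  weaken-vanishes a {p} eq = trans (eval-weaken p (lift′ a)) (trans (cong (eval p) (init-lift′ a)) eq)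

  lift-unique′ : ∀ b → Vanishes b (y ⊗ (L₂ ⊕ 1#)) → Vanishes b (L₂ ⊗ (L₁ ⊕ y)) →
                 All (Vanishes b ∘ weaken) M → b ≡ lift′ (project n (suc i) b)
  lift-unique′ b gate₁ gate₂ rest = begin
    b                              ≡⟨ init-last b ⟩
    init b ∷ʳ last b               ≡⟨ cong₂ _∷ʳ_ init-b last-b ⟩
    lift′ (project n (suc i) b)    ∎
    where
    init-b : init b ≡ lift (project n (suc i) b)
    -- The older members of `M` do not see the last coordinate, so uniqueness from the previous
    -- stage applies to `init b`.
    init-b = trans (lift-unique (init b) (All.map (λ {p} → trans (sym (eval-weaken p b))) rest))
                   (cong lift (sym (project-suc n i b)))
    last-b : last b ≡ eval ℓ₁ (project n (suc i) b) ∧ eval ℓ₂ (project n (suc i) b)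
    last-b = gate-zeros _ (eval ℓ₁ (project n (suc i) b)) _
      (trans (sym (eval-gate₁ b)) gate₁) (trans (sym (eval-gate₂ b)) gate₂)

  eval-lift′ : ∀ a → eval (y ⊕ weaken f′) (lift′ a) ≡ eval f₀ a
  eval-lift′ a = begin
    eval (y ⊕ weaken f′) (lift′ a)
      ≡⟨ eval-y⊕weaken f′ (lift′ a) ⟩
    last (lift′ a) xor eval f′ (init (lift′ a))
      ≡⟨ cong₂ (λ c b → c xor eval f′ b) (last-lift′ a) (init-lift′ a) ⟩
    (eval ℓ₁ a ∧ eval ℓ₂ a) xor eval f′ (lift a)
      ≡⟨ cong (λ a′ → (eval ℓ₁ a′ ∧ eval ℓ₂ a′) xor eval f′ (lift a)) (project-lift a) ⟨
    (eval ℓ₁ (project n i (lift a)) ∧ eval ℓ₂ (project n i (lift a))) xor eval f′ (lift a)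
      ≡⟨ eval-f (lift a) ⟨
    eval f (lift a)
      ≡⟨ eval-lift a ⟩
    eval f₀ a ∎

⟶*-invariant : ∀ {f₀ : 𝔹 n} {s s′} → s ⟶* s′ → Invariant f₀ s → Invariant f₀ s′
⟶*-invariant ε            inv = inv
⟶*-invariant (s⟶ ◅ ⟶*s′) inv = ⟶*-invariant ⟶*s′ (step-invariant s⟶ inv)

-- Splitting off a quadratic term

-- A term in the support of a weakened polynomial contains no `y`. Having it as the image of a term
-- `s` in the `x`'s lets the linear factors be chosen in `𝔹 n`.
weaken*-true : ∀ m (g : 𝔹 n) t → weaken* m g t ≡ true →
               ∃[ s ] ∣ s ∣ ≡ ∣ t ∣ × weaken* m (monomial s) ≈ monomial t
weaken*-true zero    g t eq = t , refl , λ _ → refl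
weaken*-true (suc m) g t eq with gt , t≡ ← weaken-true (weaken* m g) t eq
                            with s , ∣s∣≡ , s≈ ← weaken*-true m g (init t) gt =
  s , trans ∣s∣≡ (trans (sym (∣∷ʳoutside∣ (init t))) (cong ∣_∣ (sym t≡))) , λ u → begin
    weaken (weaken* m (monomial s)) u ≡⟨ weaken-cong s≈ u ⟩
    weaken (monomial (init t)) u      ≡⟨ weaken-monomial (init t) u ⟩
    monomial (init t ∷ʳ outside) u    ≡⟨ cong (λ t → monomial t u) t≡ ⟨
    monomial t u                      ∎
  where open ≡-Reasoning

-- Over F₂, adding a term of the support deletes it and leaves all other coefficients alone.
#nonLinearTerms-remove : ∀ (f : 𝔹 N) {t} → f t ≡ true → 2 ≤ ∣ t ∣ →
                         #nonLinearTerms (monomial t ⊕ f) < #nonLinearTerms f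
#nonLinearTerms-remove f {t} ft 2≤ = #heavy-mono-< ∣_∣ implies (terms-complete t) 2≤ removed ft
  where
  implies : ∀ {u} → 2 ≤ ∣ u ∣ → monomial t u xor f u ≡ true → f u ≡ true
  implies {u} _ eq with xor-true (monomial t u) (f u) eq
  ... | inj₁ mu with refl ← monomial-true t u mu = ft
  ... | inj₂ fu = fu
  removed : monomial t t xor f t ≡ false
  removed = cong₂ _xor_ (monomial-refl t) ft

progress : ∀ {f₀ : 𝔹 n} {s} → Invariant f₀ s → LoopGuard s → ∃ λ s′ → s ⟶ s′
progress {n} {s = state i M f} inv deg≡2
  with t , ft , ∣t∣≡2 ← deg-attained f deg≡2
  with xor-true (weaken* i (Invariant.quadratic inv) t) _ (trans (sym (Invariant.split inv t)) ft)
-- A term of size 2 cannot come from the part of degree at most 1.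
... | inj₂ linear-t =
  contradiction (Invariant.linear-degree inv t linear-t) (ℕ.<⇒≱ (ℕ.≤-reflexive (sym ∣t∣≡2)))
... | inj₁ quadratic-t
  with s , ∣s∣≡∣t∣ , s≈t ← weaken*-true i (Invariant.quadratic inv) t quadratic-t
  with a , b , a≢b , refl ← ∣t∣≡2⇒t≡⁅i⁆∪⁅j⁆ s (trans ∣s∣≡∣t∣ ∣t∣≡2) =
  -- The chosen `f′` is `f` with the term `t = xₐx_b` deleted.
  _ , step deg≡2 (x a) (x b) (monomial t ⊕ f)
        (DegreeAtMost⇒Linear (DegreeAtMost-x a)) (DegreeAtMost⇒Linear (DegreeAtMost-x b))
        (a≢b ∘ monomial-injective) decomposition
        (#nonLinearTerms-remove f ft (ℕ.≤-reflexive (sym ∣t∣≡2)))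
  where
  open ≡-Reasoning
  decomposition : f ≈ weaken* i (x a) ⊗ weaken* i (x b) ⊕ (monomial t ⊕ f)
  decomposition u = begin
    f u
      ≡⟨ xor-solve (monomial t u) (f u) refl ⟩
    monomial t u xor (monomial t u xor f u)
      ≡⟨ cong (_xor (monomial t u xor f u)) (s≈t u) ⟨
    weaken* i (monomial (⁅ a ⁆ ∪ ⁅ b ⁆)) u xor (monomial t u xor f u)
      ≡⟨ cong (_xor (monomial t u xor f u)) (weaken*-cong i (monomial-⊗ ⁅ a ⁆ ⁅ b ⁆) u) ⟨
    weaken* i (x a ⊗ x b) u xor (monomial t u xor f u)
      ≡⟨ cong (_xor (monomial t u xor f u)) (weaken*-⊗ i (x a) (x b) u) ⟩
    (weaken* i (x a) ⊗ weaken* i (x b)) u xor (monomial t u xor f u) ∎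

-- The output as a 2-XNF representation

𝒵⟨⟩⁺ : ∀ (f : 𝔹 N) {a} → eval f a ≡ false → 𝒵 ⟨ f ⟩ a
𝒵⟨⟩⁺ f {a} eq g (h , g≈) = begin
  eval g a            ≡⟨ eval-cong g≈ a ⟩
  eval (h ⊗ f) a      ≡⟨ eval-⊗ h f a ⟩
  eval h a ∧ eval f a ≡⟨ ∧-falseʳ (eval h a) eq ⟩
  false               ∎
  where open ≡-Reasoning

𝒵⟦⟧⁺ : ∀ {gs : List (𝔹 N)} {b} → All (Vanishes b) gs → 𝒵 ⟦ gs ⟧ b
𝒵⟦⟧⁺ {b = b} vanish p p∈ with All.lookupAny vanish p∈
... | eq , p≈ = trans (eval-cong p≈ b) eq

𝒵⟦⟧⁻ : ∀ {gs : List (𝔹 N)} {b} → 𝒵 ⟦ gs ⟧ b → All (Vanishes b) gs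
𝒵⟦⟧⁻ zero-b = All.tabulate λ {p} p∈ → zero-b p (Any.map (λ where refl _ → refl) p∈)

-- The members of `M` are the products and the final `f` is the single linear generator. On zeros of
-- the output, `lift` is inverse to `project`, which gives the bijection.
representation : ∀ {f₀ : 𝔹 n} {s} → Invariant f₀ s → ¬ LoopGuard s →
                 Is2XNFRepresentation (State.i s) ⟨ f₀ ⟩ (output s)
representation {n} {f₀} {state i M f} inv deg≢2 = record
  { k        = length M
  ; s        = 1
  ; f        = λ j → proj₁ (factors j)
  ; g        = λ j → proj₁ (proj₂ (factors j))
  ; ℓ        = λ _ → f
  ; f-linear = λ j → let _ , _ , g-linear , _ = factors j in DegreeAtMost⇒Linear g-linear
  ; g-linear = λ j → let _ , _ , _ , h-linear , _ = factors j in DegreeAtMost⇒Linear h-linear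
  ; ℓ-linear = λ _ → DegreeAtMost⇒Linear f-degree
  ; form     = form⇒ , form⇐
  ; zeros    = maps , (λ {b} {c} → injective {b} {c}) , surjective
  }
  where
  open Invariant inv

  factors : ∀ j → ProductOfLinears (List.lookup M j)
  factors j = All.lookup products (∈-lookup j)

  lookup≈ : ∀ j → List.lookup M j ≈ proj₁ (factors j) ⊗ proj₁ (proj₂ (factors j))
  lookup≈ j = let _ , _ , _ , _ , p≈ = factors j in p≈

  Form : 𝔹 (i + n) → Set
  Form p = (∃[ j ] p ≈ proj₁ (factors j) ⊗ proj₁ (proj₂ (factors j))) ⊎ (∃ λ (_ : Fin 1) → p ≈ f)

  form⇒ : ∀ {p} → ⟦ f ∷ M ⟧ p → Form p
  form⇒ (here p≈f)  = inj₂ (zero , p≈f)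
  form⇒ (there p∈M) =
    inj₁ (Any.index p∈M , λ t → trans (lookup-index p∈M t) (lookup≈ (Any.index p∈M) t))

  form⇐ : ∀ {p} → Form p → ⟦ f ∷ M ⟧ p
  form⇐ {p} (inj₁ (j , p≈)) =
    there (Any.map (λ where refl t → trans (p≈ t) (sym (lookup≈ j t))) (∈-lookup j))
  form⇐ (inj₂ (_ , p≈)) = here p≈

  f-degree : DegreeAtMost 1 f
  -- The failed guard only says that the degree is not 2; the decomposition in the invariant
  -- excludes larger degrees, which leaves at most 1.
  f-degree = deg≤⇒DegreeAtMost f (ℕ.≤-pred (ℕ.≤∧≢⇒< deg≤2 deg≢2))
    where
    deg≤2 : deg f ≤ 2
    deg≤2 = DegreeAtMost⇒deg≤ f (DegreeAtMost-resp-≈ (sym ∘ split)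
      (DegreeAtMost-⊕ (DegreeAtMost-weaken* i quadratic-degree)
                      (DegreeAtMost-mono (s≤s z≤n) linear-degree)))

  zero≡lift : ∀ b → 𝒵 ⟦ f ∷ M ⟧ b → b ≡ lift (project n i b)
  zero≡lift b b∈ = lift-unique b (All.tail (𝒵⟦⟧⁻ b∈))

  maps : ∀ b → 𝒵 ⟦ f ∷ M ⟧ b → 𝒵 ⟨ f₀ ⟩ (project n i b)
  maps b b∈ = 𝒵⟨⟩⁺ f₀ (begin
    eval f₀ (project n i b)       ≡⟨ eval-lift (project n i b) ⟨
    eval f (lift (project n i b)) ≡⟨ cong (eval f) (zero≡lift b b∈) ⟨
    eval f b                      ≡⟨ All.head (𝒵⟦⟧⁻ b∈) ⟩
    false                         ∎)
    where open ≡-Reasoning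

  injective : ∀ {b c : Σ _ (𝒵 ⟦ f ∷ M ⟧)} →
              project n i (proj₁ b) ≡ project n i (proj₁ c) → proj₁ b ≡ proj₁ c
  injective {b , b∈} {c , c∈} eq = begin
    b                      ≡⟨ zero≡lift b b∈ ⟩
    lift (project n i b)   ≡⟨ cong lift eq ⟩
    lift (project n i c)   ≡⟨ zero≡lift c c∈ ⟨
    c                      ∎
    where open ≡-Reasoning

  surjective : ∀ (a : Σ _ (𝒵 ⟨ f₀ ⟩)) → ∃ λ (b : Σ _ (𝒵 ⟦ f ∷ M ⟧)) →
               ∀ {c : Σ _ (𝒵 ⟦ f ∷ M ⟧)} → proj₁ c ≡ proj₁ b → project n i (proj₁ c) ≡ proj₁ a
  surjective (a , a∈) =
    -- A zero of the ideal is in particular a zero of its generator `f₀`, so the final `f` vanishes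
    -- at the lift.
    (lift a , 𝒵⟦⟧⁺ (trans (eval-lift a) (a∈ f₀ (∈⟨⟩-refl f₀)) ∷ lift-vanishes a)) ,
    λ eq → trans (cong (project n i) eq) (project-lift a)

-- Accessibility excludes infinite runs, and progress excludes getting stuck while the guard holds.
-- So every maximal run ends in a state where the guard fails, and there the output is a
-- representation.
proposition3p17 : ∀ (n : ℕ) (f : 𝔹 n) → deg f ≤ 2 →
    Acc (flip _⟶_) (start f)
    × (∀ s → start f ⟶* s → LoopGuard s → ∃ λ s′ → s ⟶ s′)
    × (∀ s → start f ⟶* s → ¬ LoopGuard s →
    Is2XNFRepresentation (State.i s) ⟨ f ⟩ (output s))
proposition3p17 n f deg≤2 =
    ⟶-wellFounded (start f)
  , (λ s start⟶*s → progress (reachable start⟶*s))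
  , (λ s start⟶*s → representation (reachable start⟶*s))
  where
  reachable : ∀ {s} → start f ⟶* s → Invariant f s
  reachable start⟶*s = ⟶*-invariant start⟶*s (start-invariant (deg≤⇒DegreeAtMost f deg≤2))
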